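{- For every $n\ge 1$, the number of web permutations of $[n]$ is equal to the Euler number $E_{n+1}$.
   Context: **Euler numbers.** $E_n$ is defined by $\sum_{n\ge 0}E_n\frac{z^n}{n!}=\sec z+\tan z$. **Web permutations.** The cells of the $n\times n$ grid are indexed by $(i,j)$ with $1\le i,j\le n$ ($i$ is the $x$-coordinate, $j$ the $y$-coordinate). For $\sigma\in\mathfrak{S}_n$, a cell $(i,j)$ is a crossing of $\sigma$ if $\sigma(i)<j$ and $i<\sigma^{ -1}(j)$; $\mathrm{Cr}(\sigma)$ is the set of crossings. A grid configuration is $G(\sigma,E)$, determined by a pair $(\sigma,E)$ with $\sigma\in\mathfrak{S}_n$ and $E\subseteq\mathrm{Cr}(\sigma)$; its remaining crossings are the elements of $\mathrm{Cr}(\sigma)\setminus E$. Order cells by $(x,y)\succeq(x',y')$ iff $x\le x'$ and $y\ge y'$. If $c=(i,j)$ is a $\succeq$-maximal remaining crossing of $G(\sigma,E)$, resolving $c$ produces two grid configurations: $G(\sigma,E\cup\{c\})$ (smoothing) and $G(\sigma',E)$ (switching), where $\sigma'(i)=j$, $\sigma'(\sigma^{ -1}(j))=\sigma(i)$, and $\sigma'(k)=\sigma(k)$ for $k\ne i,\sigma^{ -1}(j)$ (one has $E\subseteq\mathrm{Cr}(\sigma')$). Start from $G(\mathrm{id},\emptyset)$ and repeatedly replace each grid configuration having a remaining crossing by the two obtained by resolving a maximal one, until all are of the form $G(\sigma,\mathrm{Cr}(\sigma))$. The permutations $\sigma$ occurring are the web permutations of $[n]$ (the result does not depend on the choices of maximal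 crossings). -}

module Defs where

open import Data.Fin as Fin using (Fin; zero; suc; toℕ)
open import Data.Fin.Permutation as Perm
  using (Permutation′; _⟨$⟩ʳ_; _⟨$⟩ˡ_; _∘ₚ_; transpose)
open import Data.Integer as ℤ using (ℤ)
open import Data.Nat as ℕ using (ℕ; zero; suc; _∸_; _!)
import Data.Nat.Properties as ℕ
open import Data.Product using (Σ; ∃; _×_; _,_; proj₁; proj₂)
open import Data.Rational as ℚ using (ℚ; 0ℚ; 1ℚ; _/_)
import Data.Rational.Properties as ℚ
open import Data.Vec.Functional as Vector using (Vector)
open import Function.Bundles using (Bijection)
open import Level using (0ℓ) renaming (suc to lsuc)
open import Relation.Binary.Bundles using (Setoid)
import Relation.Binary.Construct.On as On
open import Relation.Binary.Construct.Closure.ReflexiveTransitive using (Star)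
open import Relation.Binary.PropositionalEquality
  using (_≡_; _≢_; refl; sym; trans; cong; cong₂; setoid; module ≡-Reasoning)
open import Relation.Nullary.Decidable using (yes; no; dec-true; dec-false)
open import Relation.Unary using (Pred; _∈_; _⊆_; _∪_; _∖_; ∅; ｛_｝)

open import Algebra.Properties.CommutativeMonoid.Sum ℚ.+-0-commutativeMonoid
  using (sum; sum-cong-≗)

-- f n is the coefficient of zⁿ.
Series : Set
Series = ℕ → ℚ

infixl 6 _⊕_
infixl 7 _⊛_

_⊕_ : Series → Series → Series
(f ⊕ g) n = f n ℚ.+ g n

_⊛_ : Series → Series → Series
(f ⊛ g) n = sum {suc n} λ k → f (toℕ k) ℚ.* g (n ∸ toℕ k)

one : Series
one zero    = 1ℚ
one (suc _) = 0ℚ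

-- For f with constant term 1, the coefficients of 1/f are determined by
-- b₀ = 1 and bₙ₊₁ = - Σ_{k ≤ n} fₖ₊₁ bₙ₋ₖ.  The vector  recipCoeffs f n  is
-- (bₙ , bₙ₋₁ , … , b₀), in decreasing order of the index.
recipCoeffs : Series → ∀ n → Vector ℚ (suc n)
recipCoeffs f zero    = λ _ → 1ℚ
recipCoeffs f (suc n) =
  (ℚ.- sum λ k → f (suc (toℕ k)) ℚ.* recipCoeffs f n k)
    Vector.∷ recipCoeffs f n

recip : Series → Series
recip f n = recipCoeffs f n zero

recipCoeffs-recip : ∀ f n k → recipCoeffs f n k ≡ recip f (n ∸ toℕ k)
recipCoeffs-recip f zero    zero    = refl
recipCoeffs-recip f (suc n) zero    = refl
recipCoeffs-recip f (suc n) (suc k) = recipCoeffs-recip f n k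

⊛-recip : ∀ f → f 0 ≡ 1ℚ → ∀ n → (f ⊛ recip f) n ≡ one n
⊛-recip f f₀≡1 zero    = trans (ℚ.+-identityʳ _) (trans (ℚ.*-identityʳ _) f₀≡1)
⊛-recip f f₀≡1 (suc n) = begin
  f 0 ℚ.* ℚ.- s ℚ.+ s′  ≡⟨ cong₂ (λ a b → a ℚ.* ℚ.- s ℚ.+ b) f₀≡1 (sym s≡s′) ⟩
  1ℚ ℚ.* ℚ.- s ℚ.+ s    ≡⟨ cong (ℚ._+ s) (ℚ.*-identityˡ (ℚ.- s)) ⟩
  ℚ.- s ℚ.+ s           ≡⟨ ℚ.+-inverseˡ s ⟩
  0ℚ                    ∎
  where
  open ≡-Reasoning
  s s′ : ℚ
  s  = sum {suc n} λ k → f (suc (toℕ k)) ℚ.* recipCoeffs f n k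
  s′ = sum {suc n} λ k → f (suc (toℕ k)) ℚ.* recip f (n ∸ toℕ k)
  s≡s′ : s ≡ s′
  s≡s′ = sum-cong-≗ {suc n} λ k → cong (f (suc (toℕ k)) ℚ.*_) (recipCoeffs-recip f n k)

-- The series Σ aₙ zⁿ / n!.
egf : (ℕ → ℤ) → Series
egf a n = (a n / (n !)) {{n ℕ.!≢0}}

-- n-th derivatives at 0 of cos and sin.
cos⁽_⁾ sin⁽_⁾ : ℕ → ℤ
cos⁽ 0 ⁾           = ℤ.1ℤ
cos⁽ 1 ⁾           = ℤ.0ℤ
cos⁽ suc (suc n) ⁾ = ℤ.- cos⁽ n ⁾
sin⁽ 0 ⁾           = ℤ.0ℤ
sin⁽ 1 ⁾           = ℤ.1ℤ
sin⁽ suc (suc n) ⁾ = ℤ.- sin⁽ n ⁾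

cos sin sec tan : Series
cos = egf cos⁽_⁾
sin = egf sin⁽_⁾
sec = recip cos
tan = sin ⊛ sec

-- Eₙ = n! [zⁿ] (sec z + tan z).  It is kept as a rational number because
-- integrality is not apparent from the generating function.
euler : ℕ → ℚ
euler n = ℤ.+ (n !) / 1 ℚ.* (sec ⊕ tan) n

-- Coordinates are 0-based.
Cell : ℕ → Set
Cell n = Fin n × Fin n

_⪰_ : ∀ {n} → Cell n → Cell n → Set
(x , y) ⪰ (x′ , y′) = x Fin.≤ x′ × y Fin.≥ y′

Cr : ∀ {n} → Permutation′ n → Pred (Cell n) 0ℓ
Cr σ (i , j) = σ ⟨$⟩ʳ i Fin.< j × i Fin.< σ ⟨$⟩ˡ j

record Config (n : ℕ) : Set₁ where
  constructor G
  field
    σ    : Permutation′ n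
    E    : Pred (Cell n) 0ℓ
    E⊆Cr : E ⊆ Cr σ

open Config public

Remaining : ∀ {n} → Config n → Pred (Cell n) 0ℓ
Remaining g = Cr (σ g) ∖ E g

MaximalRemaining : ∀ {n} → Config n → Pred (Cell n) 0ℓ
MaximalRemaining g c =
  c ∈ Remaining g × (∀ {c′} → c′ ∈ Remaining g → c′ ⪰ c → c′ ≡ c)

-- _∘ₚ_ applies its left argument first.
switch : ∀ {n} → Permutation′ n → Cell n → Permutation′ n
switch σ (i , j) = transpose i (σ ⟨$⟩ˡ j) ∘ₚ σ

module _ {n} (σ : Permutation′ n) (i j : Fin n) where

  switch-i : switch σ (i , j) ⟨$⟩ʳ i ≡ j
  switch-i rewrite dec-true (i Fin.≟ i) refl = Perm.inverseʳ σ

  switch-σ⁻¹j : switch σ (i , j) ⟨$⟩ʳ (σ ⟨$⟩ˡ j) ≡ σ ⟨$⟩ʳ i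
  switch-σ⁻¹j with σ ⟨$⟩ˡ j Fin.≟ i
  ... | yes σ⁻¹j≡i = cong (σ ⟨$⟩ʳ_) σ⁻¹j≡i
  ... | no _ rewrite dec-true (σ ⟨$⟩ˡ j Fin.≟ σ ⟨$⟩ˡ j) refl = refl

  switch-other : ∀ {k} → k ≢ i → k ≢ σ ⟨$⟩ˡ j →
                 switch σ (i , j) ⟨$⟩ʳ k ≡ σ ⟨$⟩ʳ k
  switch-other {k} k≢i k≢σ⁻¹j
    rewrite dec-false (k Fin.≟ i) k≢i
          | dec-false (k Fin.≟ σ ⟨$⟩ˡ j) k≢σ⁻¹j = refl

infix 4 _⟶_ _⟶*_

-- g ⟶ h: h is one of the two configurations produced by resolving some
-- maximal remaining crossing of g.  The proof that the new set consists of
-- crossings is an arbitrary argument of each constructor; for `switching' the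
-- inclusion holds for configurations reachable from G(id, ∅), but not for
-- every configuration.
data _⟶_ {n : ℕ} (g : Config n) : Config n → Set₁ where
  smoothing : ∀ {c} → MaximalRemaining g c →
              (p : E g ∪ ｛ c ｝ ⊆ Cr (σ g)) →
              g ⟶ G (σ g) (E g ∪ ｛ c ｝) p
  switching : ∀ {c} → MaximalRemaining g c →
              (p : E g ⊆ Cr (switch (σ g) c)) →
              g ⟶ G (switch (σ g) c) (E g) p

_⟶*_ : ∀ {n} → Config n → Config n → Set₁
_⟶*_ = Star _⟶_

initial : ∀ n → Config n
initial n = G Perm.id ∅ λ ()

-- Since E ⊆ Cr(σ) always holds, this says E = Cr(σ).
Resolved : ∀ {n} → Config n → Set
Resolved g = Cr (σ g) ⊆ E g

-- π occurs for some choices of maximal crossings; the set of permutations that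
-- occur is the same for all choices.  Permutations are records of functions, so
-- they are compared pointwise.
IsWeb : ∀ {n} → Pred (Permutation′ n) (lsuc 0ℓ)
IsWeb {n} π = ∃ λ g → initial n ⟶* g × Resolved g × σ g Perm.≈ π

permutations : ℕ → Setoid 0ℓ 0ℓ
permutations n = record
  { Carrier       = Permutation′ n
  ; _≈_           = Perm._≈_
  ; isEquivalence = record
    { refl  = λ _ → refl
    ; sym   = λ π≈ρ i → sym (π≈ρ i)
    ; trans = λ π≈ρ ρ≈τ i → trans (π≈ρ i) (ρ≈τ i)
    }
  }

webPermutations : ℕ → Setoid (lsuc 0ℓ) 0ℓ
webPermutations n = On.setoid {B = Σ (Permutation′ n) IsWeb} (permutations n) proj₁

HasCardinality : ∀ {a ℓ} → Setoid a ℓ → ℕ → Set _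
HasCardinality S k = Bijection (setoid (Fin k)) S

{-# OPTIONS --safe #-}
-- A permutation σ is a web permutation iff it is tame: every x is the end of an
-- orbit segment s, σ s, …, x with s ≤ σ x whose points other than x are smaller
-- than x.  Switching a maximal crossing joins two orbit segments and creates such
-- a segment for good; conversely, the columns of a tame σ can be resolved from
-- left to right, column i being switched once, to the value σ i, or not at all.
--
-- Following the points in increasing order, a tame permutation is built out of
-- open paths, the orbit segments still to be continued.  When m paths are open,
-- the next point starts a path (1 way), is a fixed point or prolongs a path
-- (m + 1 ways), or prolongs a path and leads to its start or to the larger start
-- of another path (m(m + 1)/2 ways).  Hence tame permutations are counted by
-- Motzkin paths with these weights.
--
-- Let Z = sec + tan and U = Z - 1, so that Z′ = 1 + U + U²/2.  The exponential
-- generating functions of the completions of m open paths are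
-- (m + 1)!/2ᵐ Z′ Uᵐ, because these satisfy the differential equations that the
-- weights prescribe.  For m = 0 this is Z′, with coefficients Eₙ₊₁.
module Submission where

open import Defs
open import Algebra.Bundles using (CommutativeRing)
import Algebra.Solver.Ring.NaturalCoefficients.Default as NaturalCoefficients
open import Data.Fin as Fin using (Fin; zero; suc; toℕ; fromℕ<; punchIn; punchOut)
import Data.Fin.Properties as Fin
open import Data.Fin.Permutation as Perm using (Permutation′; _⟨$⟩ʳ_; _⟨$⟩ˡ_)
open import Data.Integer as ℤ using (ℤ; +_)
import Data.Integer.Properties as ℤ
open import Data.Nat as ℕ using (ℕ; zero; suc; _≤_; _!)
import Data.Nat.Properties as ℕ
open import Data.Product as Product using (∃; ∃₂; _×_; _,_; proj₁; proj₂)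
open import Data.Product.Function.NonDependent.Propositional using (_×-↔_)
open import Data.Rational as ℚ using (ℚ; 0ℚ; 1ℚ; ½; _/_)
import Data.Rational.Properties as ℚ
import Data.Rational.Solver as ℚ-Solver
open import Data.Rational.Unnormalised as ℚᵘ using (mkℚᵘ; *≡*)
import Data.Rational.Unnormalised.Properties as ℚᵘ
open import Data.Sum using (_⊎_; inj₁; inj₂)
open import Data.Sum.Function.Propositional using (_⊎-↔_)
open import Data.Vec.Functional using (Vector; removeAt) renaming (_∷_ to _◂_; [] to ⟨⟩)
open import Function using (_∘_; flip; _↔_; mk↔ₛ′; Inverse; Injection)
open import Function.Construct.Identity using (↔-id)
open import Function.Properties.Inverse using (↔-trans; ↔⇒↣)
open import Level using (0ℓ)
open import Relation.Binary.Bundles using (Setoid)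
open import Relation.Binary.Construct.Closure.ReflexiveTransitive using (ε; _◅_; _◅◅_)
open import Relation.Binary.Definitions using (tri<; tri≈; tri>)
open import Relation.Binary.PropositionalEquality
  using (_≡_; _≢_; _≗_; refl; sym; trans; cong; cong₂; subst; subst₂; _→-setoid_; module ≡-Reasoning)
import Relation.Binary.Reasoning.Setoid as SetoidReasoning
open import Relation.Nullary using (¬_; Dec; yes; no; contradiction)
open import Relation.Nullary.Decidable using (_×-dec_)
open import Relation.Unary using (Pred; _∈_)

open import Algebra.Properties.CommutativeMonoid.Sum ℚ.+-0-commutativeMonoid
  using (sum; sum-cong-≗; sum-init-last; ∑-distrib-+)
open import Algebra.Properties.Semiring.Sum (CommutativeRing.semiring ℚ.+-*-commutativeRing)
  using (*-distribˡ-sum)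

-- How a switch changes the crossings

module _ {n : ℕ} (σ : Permutation′ n) where

  ⟨$⟩ʳ-injective : ∀ {x y} → σ ⟨$⟩ʳ x ≡ σ ⟨$⟩ʳ y → x ≡ y
  ⟨$⟩ʳ-injective = Injection.injective (↔⇒↣ σ)

  ⟨$⟩ˡ-unique : ∀ {x y} → σ ⟨$⟩ʳ x ≡ y → σ ⟨$⟩ˡ y ≡ x
  ⟨$⟩ˡ-unique refl = Perm.inverseˡ σ

  crossing : ∀ {x y z} → σ ⟨$⟩ʳ z ≡ y → x Fin.< z → σ ⟨$⟩ʳ x Fin.< y → (x , y) ∈ Cr σ
  crossing {x} σz≡y x<z σx<y = σx<y , subst (x Fin.<_) (sym (⟨$⟩ˡ-unique σz≡y)) x<z

  -- Only the graph points of `i` and `k` move, so a crossing can be new only if `x ≡ k` or `z ≡ k`;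
  -- in each such case it is old after all or lies weakly right of and below `(i , j)`. Thus new
  -- crossings are dominated by the resolved one.
  switch-crossing : ∀ {i j x y} → (i , j) ∈ Cr σ → (x , y) ∈ Cr (switch σ (i , j)) →
                    (x , y) ∈ Cr σ ⊎ (i , j) ⪰ (x , y)
  switch-crossing {i} {j} {x} {y} (σi<j , i<k) (σ′x<y , x<z) =
    go (x Fin.≟ i) (x Fin.≟ k) (z Fin.≟ i) (z Fin.≟ k)
    where
    σ′ = switch σ (i , j)
    k = σ ⟨$⟩ˡ j
    z = σ′ ⟨$⟩ˡ y
    σ′z≡y : σ′ ⟨$⟩ʳ z ≡ y
    σ′z≡y = Perm.inverseʳ σ′
    σ′i≡j : σ′ ⟨$⟩ʳ i ≡ j
    σ′i≡j = switch-i σ i j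
    σ′k≡σi : σ′ ⟨$⟩ʳ k ≡ σ ⟨$⟩ʳ i
    σ′k≡σi = switch-σ⁻¹j σ i j
    y≡j : z ≡ i → y ≡ j
    y≡j z≡i = trans (sym σ′z≡y) (trans (cong (σ′ ⟨$⟩ʳ_) z≡i) σ′i≡j)
    y≡σi : z ≡ k → y ≡ σ ⟨$⟩ʳ i
    y≡σi z≡k = trans (sym σ′z≡y) (trans (cong (σ′ ⟨$⟩ʳ_) z≡k) σ′k≡σi)
    σz≡y : z ≢ i → z ≢ k → σ ⟨$⟩ʳ z ≡ y
    σz≡y z≢i z≢k = trans (sym (switch-other σ i j z≢i z≢k)) σ′z≡y

    go : _ → _ → _ → _ → (x , y) ∈ Cr σ ⊎ (i , j) ⪰ (x , y)
    go (yes refl) _ (yes z≡i) _ = contradiction (sym z≡i) (Fin.<⇒≢ x<z)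
    go (yes refl) _ (no _) (yes z≡k) =
      contradiction (subst₂ Fin._<_ σ′i≡j (y≡σi z≡k) σ′x<y) (Fin.<-asym σi<j)
    go (yes refl) _ (no z≢i) (no z≢k) =
      inj₁ (crossing (σz≡y z≢i z≢k) x<z (Fin.<-trans σi<j (subst (Fin._< y) σ′i≡j σ′x<y)))
    go (no _) (yes refl) (yes z≡i) _ =
      inj₂ (ℕ.<⇒≤ i<k , Fin.≤-reflexive (y≡j z≡i))
    go (no _) (yes refl) (no _) (yes z≡k) = contradiction (sym z≡k) (Fin.<⇒≢ x<z)
    go (no _) (yes refl) (no z≢i) (no z≢k) with j Fin.<? y
    ... | yes j<y = inj₁ (crossing (σz≡y z≢i z≢k) x<z
                      (subst (Fin._< y) (sym (Perm.inverseʳ σ)) j<y))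
    ... | no  j≮y = inj₂ (ℕ.<⇒≤ i<k , ℕ.≮⇒≥ j≮y)
    go (no x≢i) (no x≢k) (yes z≡i) _ =
      inj₁ (crossing (trans (Perm.inverseʳ σ) (sym (y≡j z≡i)))
        (Fin.<-trans (subst (x Fin.<_) z≡i x<z) i<k)
        (subst (Fin._< y) (switch-other σ i j x≢i x≢k) σ′x<y))
    go (no x≢i) (no x≢k) (no _) (yes z≡k) with x Fin.<? i
    ... | yes x<i = inj₁ (crossing (sym (y≡σi z≡k)) x<i
                      (subst (Fin._< y) (switch-other σ i j x≢i x≢k) σ′x<y))
    ... | no  x≮i = inj₂ (ℕ.≮⇒≥ x≮i , ℕ.<⇒≤ (subst (Fin._< j) (sym (y≡σi z≡k)) σi<j))
    go (no x≢i) (no x≢k) (no z≢i) (no z≢k) =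
      inj₁ (crossing (σz≡y z≢i z≢k) x<z (subst (Fin._< y) (switch-other σ i j x≢i x≢k) σ′x<y))

-- Path f R s x: x is an iterate of s under f, and R holds at every point of
-- the orbit segment from s to x except possibly x itself.
data Path {A : Set} (f : A → A) (R : Pred A 0ℓ) (s : A) : A → Set where
  []   : Path f R s s
  step : ∀ {y z} → Path f R s y → R y → f y ≡ z → Path f R s z

module _ {A : Set} {f : A → A} {R : Pred A 0ℓ} where

  _++_ : ∀ {x y z} → Path f R x y → Path f R y z → Path f R x z
  p ++ []          = p
  p ++ step q r eq = step (p ++ q) r eq

  start-from : ∀ {s s′ x} → s ≡ s′ → Path f R s x → Path f R s′ x
  start-from refl p = p

  mapPath : ∀ {g : A → A} {S : Pred A 0ℓ} → (∀ {y} → R y → S y × g y ≡ f y) →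
        ∀ {x z} → Path f R x z → Path g S x z
  mapPath φ []            = []
  mapPath φ (step p r eq) = let s , g≡f = φ r in step (mapPath φ p) s (trans g≡f eq)

-- Tame permutations

Tame : ∀ {n} → Permutation′ n → Set
Tame σ = ∀ x → ∃ λ s → s Fin.≤ σ ⟨$⟩ʳ x × Path (σ ⟨$⟩ʳ_) (Fin._< x) s x

Tame-resp-≈ : ∀ {n} {σ τ : Permutation′ n} → σ Perm.≈ τ → Tame σ → Tame τ
Tame-resp-≈ σ≈τ tame x =
  let s , s≤ , p = tame x
  in s , subst (s Fin.≤_) (σ≈τ x) s≤ , mapPath (λ {y} y<x → y<x , sym (σ≈τ y)) p

-- Tameness of σ at a point y of a path from c gives a path from some s ≤ σ y to y
-- that cannot go back beyond c; so s lies on the first path, and either s is c or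
-- s is the value of σ at an earlier point.
module _ {n : ℕ} {σ : Permutation′ n} (tame : Tame σ) {b : ℕ} {c : Fin n}
         (before-c : ∀ {z} → σ ⟨$⟩ʳ z ≡ c → b ℕ.≤ toℕ z) where

  private
    R : ℕ → Pred (Fin n) 0ℓ
    R b y = toℕ y ℕ.< b

  start-minimal  : ∀ {y b′ s} → Path (σ ⟨$⟩ʳ_) (R b) c y → b′ ℕ.≤ b →
                   Path (σ ⟨$⟩ʳ_) (R b′) s y → c Fin.≤ s
  start≤target : ∀ {y} → Path (σ ⟨$⟩ʳ_) (R b) c y → toℕ y ℕ.≤ b → c Fin.≤ σ ⟨$⟩ʳ y

  start-minimal []             _    []               = Fin.≤-refl
  start-minimal []             b′≤b (step _ y<b′ eq) =
    contradiction (before-c eq) (ℕ.<⇒≱ (ℕ.<-≤-trans y<b′ b′≤b))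
  start-minimal (step p y<b eq) _    []              =
    subst (c Fin.≤_) eq (start≤target p (ℕ.<⇒≤ y<b))
  start-minimal (step p _ eq)  b′≤b (step q _ eq′)
    with refl ← ⟨$⟩ʳ-injective σ (trans eq (sym eq′)) = start-minimal p b′≤b q

  start≤target {y} p y≤b =
    let s , s≤σy , q = tame y in ℕ.≤-trans (start-minimal p y≤b q) s≤σy

-- Web permutations are tame

module _ {n : ℕ} where

  -- Switching a maximal crossing (i , j) moves no settled point, and settles i.
  Settled : Config n → Pred (Fin n) 0ℓ
  Settled g y = ∀ c → c ∈ Remaining g → ¬ c ⪰ (y , σ g ⟨$⟩ʳ y)

  -- For x not settled the path starts at σ x, so that a switch, which swaps the
  -- values of two such points i < k, can append the path of k to that of i.
  Linked : Config n → Set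
  Linked g = ∀ x → ∃ λ s →
    Path (σ g ⟨$⟩ʳ_) (λ y → y Fin.< x × y ∈ Settled g) s x ×
    (s ≡ σ g ⟨$⟩ʳ x ⊎ (x ∈ Settled g × s Fin.≤ σ g ⟨$⟩ʳ x))

  ⪰-trans : ∀ {a b c : Cell n} → a ⪰ b → b ⪰ c → a ⪰ c
  ⪰-trans (p , q) (p′ , q′) = ℕ.≤-trans p p′ , ℕ.≤-trans q′ q

  ⪰-antisym : ∀ {a b : Cell n} → a ⪰ b → b ⪰ a → a ≡ b
  ⪰-antisym (p , q) (p′ , q′) = cong₂ _,_ (Fin.≤-antisym p p′) (Fin.≤-antisym q′ q)

  -- Smoothing shrinks the set of remaining crossings, so settled points stay settled. Before a
  -- switch, the paths of the unsettled points `i` and `k` start at `σ i` and `σ k ≡ j`. Point `i`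
  -- keeps its path, whose start is below the new value `j`; point `k` gets the path of `i`, the
  -- step to `j` and its own path, starting at the new value `σ i`.
  Linked-⟶ : ∀ {g h} → g ⟶ h → Linked g → Linked h
  Linked-⟶ {g} (smoothing {c} _ p) linked x = transport (linked x)
    where
    h = G (σ g) _ p
    settled : ∀ {y} → y ∈ Settled g → y ∈ Settled h
    settled sy c (cr , ∉E∪c) = sy c (cr , ∉E∪c ∘ inj₁)
    transport : _ → _
    transport (s , path , inj₁ s≡) =
      s , mapPath (λ (y<x , sy) → (y<x , settled sy) , refl) path , inj₁ s≡
    transport (s , path , inj₂ (sx , s≤)) =
      s , mapPath (λ (y<x , sy) → (y<x , settled sy) , refl) path , inj₂ (settled sx , s≤)
  Linked-⟶ {g} (switching {i , j} (c∈rem@(c∈Cr@(σi<j , i<k) , _) , max) p) linked x =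
    go (x Fin.≟ i) (x Fin.≟ k)
    where
    k = σ g ⟨$⟩ˡ j
    σ′ = switch (σ g) (i , j)
    h = G σ′ (E g) p
    c = i , j
    σk≡j : σ g ⟨$⟩ʳ k ≡ j
    σk≡j = Perm.inverseʳ (σ g)
    i-unsettled : ¬ i ∈ Settled g
    i-unsettled si = si c c∈rem (Fin.≤-refl , ℕ.<⇒≤ σi<j)
    k-unsettled : ¬ k ∈ Settled g
    k-unsettled sk = sk c c∈rem (ℕ.<⇒≤ i<k , Fin.≤-reflexive σk≡j)
    unmoved : ∀ {y} → y ∈ Settled g → σ′ ⟨$⟩ʳ y ≡ σ g ⟨$⟩ʳ y
    unmoved sy = switch-other (σ g) i j
      (λ y≡i → i-unsettled (subst (_∈ Settled g) y≡i sy))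
      (λ y≡k → k-unsettled (subst (_∈ Settled g) y≡k sy))
    settled : ∀ {y} → y ∈ Settled g → y ∈ Settled h
    settled {y} sy c′ (cr , ∉E) c′⪰ with switch-crossing (σ g) c∈Cr cr
    ... | inj₁ cr′  = sy c′ (cr′ , ∉E) (subst (λ v → c′ ⪰ (y , v)) (unmoved sy) c′⪰)
    -- A new crossing is dominated by `c`; if it dominated the point of `y`, so would `c`, but `y`
    -- is settled.
    ... | inj₂ c⪰c′ = sy c c∈rem (⪰-trans c⪰c′ (subst (λ v → c′ ⪰ (y , v)) (unmoved sy) c′⪰))
    c∉Cr : ¬ c ∈ Cr σ′
    c∉Cr (σ′i<j , _) = Fin.<-irrefl (switch-i (σ g) i j) σ′i<j
    i-settled : i ∈ Settled h
    -- Old crossings that dominate `c` equal `c` by maximality, and new ones are dominated by `c`;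
    -- so the crossing could only be `c` itself, which the switch has destroyed.
    i-settled c′ (cr , ∉E) c′⪰ =
      c∉Cr (subst (_∈ Cr σ′) c′≡c cr)
      where
      c′⪰c : c′ ⪰ c
      c′⪰c = subst (λ v → c′ ⪰ (i , v)) (switch-i (σ g) i j) c′⪰
      c′≡c : c′ ≡ c
      c′≡c with switch-crossing (σ g) c∈Cr cr
      ... | inj₁ cr′  = max (cr′ , ∉E) c′⪰c
      ... | inj₂ c⪰c′ = ⪰-antisym c′⪰c c⪰c′
    lift : ∀ {s y x} → y Fin.≤ x → Path (σ g ⟨$⟩ʳ_) (λ z → z Fin.< y × z ∈ Settled g) s y →
           Path (σ′ ⟨$⟩ʳ_) (λ z → z Fin.< x × z ∈ Settled h) s y
    lift y≤x = mapPath λ (z<y , sz) → (ℕ.<-≤-trans z<y y≤x , settled sz) , unmoved sz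
    path : ∀ {y} → ¬ y ∈ Settled g → Path (σ g ⟨$⟩ʳ_) (λ z → z Fin.< y × z ∈ Settled g) (σ g ⟨$⟩ʳ y) y
    path {y} y∉ with linked y
    ... | s , q , inj₁ refl     = q
    ... | s , q , inj₂ (sy , _) = contradiction sy y∉

    go : _ → _ → ∃ λ s → Path (σ′ ⟨$⟩ʳ_) (λ y → y Fin.< x × y ∈ Settled h) s x ×
                          (s ≡ σ′ ⟨$⟩ʳ x ⊎ (x ∈ Settled h × s Fin.≤ σ′ ⟨$⟩ʳ x))
    go (yes refl) _ =
      _ , lift Fin.≤-refl (path i-unsettled) ,
      inj₂ (i-settled , subst (σ g ⟨$⟩ʳ i Fin.≤_) (sym (switch-i (σ g) i j)) (ℕ.<⇒≤ σi<j))
    go (no _) (yes refl) =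
      _ , step (lift (ℕ.<⇒≤ i<k) (path i-unsettled)) (i<k , i-settled)
            (trans (switch-i (σ g) i j) (sym σk≡j))
          ++ lift Fin.≤-refl (path k-unsettled) ,
      inj₁ (sym (switch-σ⁻¹j (σ g) i j))
    go (no x≢i) (no x≢k) with linked x
    ... | s , q , inj₁ s≡ =
      s , lift Fin.≤-refl q , inj₁ (trans s≡ (sym (switch-other (σ g) i j x≢i x≢k)))
    ... | s , q , inj₂ (sx , s≤) =
      s , lift Fin.≤-refl q ,
      inj₂ (settled sx , subst (s Fin.≤_) (sym (switch-other (σ g) i j x≢i x≢k)) s≤)

  Linked-⟶* : ∀ {g h} → g ⟶* h → Linked g → Linked h
  Linked-⟶* ε          = λ linked → linked
  Linked-⟶* (g⟶ ◅ ⟶*h) = Linked-⟶* ⟶*h ∘ Linked-⟶ g⟶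

  Linked⇒Tame : ∀ {g} → Linked g → Tame (σ g)
  Linked⇒Tame linked x with linked x
  ... | s , p , inj₁ s≡       = s , Fin.≤-reflexive s≡ , mapPath (λ (y<x , _) → y<x , refl) p
  ... | s , p , inj₂ (_ , s≤) = s , s≤ , mapPath (λ (y<x , _) → y<x , refl) p

IsWeb⇒Tame : ∀ {n} {π : Permutation′ n} → IsWeb π → Tame π
IsWeb⇒Tame {π = π} (g , path , _ , σ≈π) =
  Tame-resp-≈ {σ = σ g} {τ = π} σ≈π (Linked⇒Tame {g = g} (Linked-⟶* path λ x → x , [] , inj₁ refl))

-- Resolving the crossings column by column

Cr? : ∀ {n} (τ : Permutation′ n) (c : Cell n) → Dec (c ∈ Cr τ)
Cr? τ (i , j) = (τ ⟨$⟩ʳ i Fin.<? j) ×-dec (i Fin.<? τ ⟨$⟩ˡ j)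

-- The cells that precede (i , j) when the columns are read from left to right
-- and each column from top to bottom.
Before : ∀ {n} → Fin n → ℕ → Pred (Cell n) 0ℓ
Before i j (x , y) = x Fin.< i ⊎ (x ≡ i × j ℕ.≤ toℕ y)

module _ {n : ℕ} where

  SmoothedOn : Pred (Cell n) 0ℓ → Config n → Set
  SmoothedOn D g = ∀ c → (c ∈ E g → c ∈ Cr (σ g) × c ∈ D) × (c ∈ Cr (σ g) → c ∈ D → c ∈ E g)

  -- The reading order refines dominance: a cell that dominates `(i , j)` stands in an earlier
  -- column or weakly higher in column `i`, so every such crossing other than `(i , j)` has been
  -- smoothed.
  first-maximal : ∀ {g} {i j : Fin n} → SmoothedOn (Before i (suc (toℕ j))) g →
                  (i , j) ∈ Cr (σ g) → MaximalRemaining g (i , j)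
  first-maximal {g} {i} {j} smoothed cr = (cr , not-smoothed) , first
    where
    not-smoothed : ¬ (i , j) ∈ E g
    not-smoothed e with proj₂ (proj₁ (smoothed _) e)
    ... | inj₁ i<i       = Fin.<-irrefl refl i<i
    ... | inj₂ (_ , j<j) = ℕ.<-irrefl refl j<j
    first : ∀ {c} → c ∈ Remaining g → c ⪰ (i , j) → c ≡ (i , j)
    first {x , y} (cr′ , ∉E) (x≤i , j≤y) with ℕ.m≤n⇒m<n∨m≡n x≤i | ℕ.m≤n⇒m<n∨m≡n j≤y
    ... | inj₁ x<i | _         = contradiction (proj₂ (smoothed _) cr′ (inj₁ x<i)) ∉E
    ... | inj₂ x≡i | inj₁ j<y  =
      contradiction (proj₂ (smoothed _) cr′ (inj₂ (Fin.toℕ-injective x≡i , j<y))) ∉E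
    ... | inj₂ x≡i | inj₂ j≡y  = cong₂ _,_ (Fin.toℕ-injective x≡i) (sym (Fin.toℕ-injective j≡y))

  smooth-cell : ∀ {g} {i j : Fin n} → SmoothedOn (Before i (suc (toℕ j))) g →
                ∃ λ h → g ⟶* h × σ h ≡ σ g × SmoothedOn (Before i (toℕ j)) h
  smooth-cell {g} {i} {j} smoothed with Cr? (σ g) (i , j)
  ... | yes cr = _ , smoothing (first-maximal {g} smoothed cr) p ◅ ε , refl , λ c → to c , from c
    where
    p : ∀ {c} → c ∈ E g ⊎ (i , j) ≡ c → c ∈ Cr (σ g)
    p (inj₁ e)    = proj₁ (proj₁ (smoothed _) e)
    p (inj₂ refl) = cr
    to : ∀ c → c ∈ E g ⊎ (i , j) ≡ c → c ∈ Cr (σ g) × c ∈ Before i (toℕ j)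
    to c (inj₁ e) with proj₁ (smoothed _) e
    ... | cr′ , inj₁ x<i        = cr′ , inj₁ x<i
    ... | cr′ , inj₂ (x≡i , j<) = cr′ , inj₂ (x≡i , ℕ.<⇒≤ j<)
    to c (inj₂ refl) = cr , inj₂ (refl , ℕ.≤-refl)
    from : ∀ c → c ∈ Cr (σ g) → c ∈ Before i (toℕ j) → c ∈ E g ⊎ (i , j) ≡ c
    from c cr′ (inj₁ x<i) = inj₁ (proj₂ (smoothed _) cr′ (inj₁ x<i))
    from (x , y) cr′ (inj₂ (x≡i , j≤y)) with ℕ.m≤n⇒m<n∨m≡n j≤y
    ... | inj₁ j<y = inj₁ (proj₂ (smoothed _) cr′ (inj₂ (x≡i , j<y)))
    ... | inj₂ j≡y = inj₂ (cong₂ _,_ (sym x≡i) (Fin.toℕ-injective j≡y))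
  ... | no ¬cr = g , ε , refl , λ c → to c , from c
    where
    to : ∀ c → c ∈ E g → c ∈ Cr (σ g) × c ∈ Before i (toℕ j)
    to c e with proj₁ (smoothed _) e
    ... | cr′ , inj₁ x<i        = cr′ , inj₁ x<i
    ... | cr′ , inj₂ (x≡i , j<) = cr′ , inj₂ (x≡i , ℕ.<⇒≤ j<)
    from : ∀ c → c ∈ Cr (σ g) → c ∈ Before i (toℕ j) → c ∈ E g
    from c cr′ (inj₁ x<i) = proj₂ (smoothed _) cr′ (inj₁ x<i)
    from (x , y) cr′ (inj₂ (x≡i , j≤y)) with ℕ.m≤n⇒m<n∨m≡n j≤y
    ... | inj₁ j<y = proj₂ (smoothed _) cr′ (inj₂ (x≡i , j<y))
    ... | inj₂ j≡y = contradiction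
      (subst (_∈ Cr (σ g)) (cong₂ _,_ x≡i (sym (Fin.toℕ-injective j≡y))) cr′) ¬cr

  -- Induction from the top of column `i` downwards, `d` being the number of rows from `j` upwards.
  -- `Before i n` contains no cell of column `i`, since rows are numbered below `n`.
  smooth-above : ∀ {i : Fin n} d j {g} → d ℕ.+ j ≡ n → SmoothedOn (Before i n) g →
                 ∃ λ h → g ⟶* h × σ h ≡ σ g × SmoothedOn (Before i j) h
  smooth-above zero    j {g} refl smoothed = g , ε , refl , smoothed
  smooth-above {i} (suc d) j eq   smoothed
    with j<n ← ℕ.≤-trans (ℕ.m≤n+m (suc j) d) (ℕ.≤-reflexive (trans (ℕ.+-suc d j) eq))
    with g₁ , path₁ , σ₁≡ , smoothed₁ ← smooth-above d (suc j) (trans (ℕ.+-suc d j) eq) smoothed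
    with g₂ , path₂ , σ₂≡ , smoothed₂ ←
           smooth-cell {g₁} {i} {fromℕ< j<n}
             (subst (λ k → SmoothedOn (Before i (suc k)) g₁) (sym (Fin.toℕ-fromℕ< j<n)) smoothed₁)
    = g₂ , path₁ ◅◅ path₂ , trans σ₂≡ σ₁≡ ,
      subst (λ k → SmoothedOn (Before i k) g₂) (Fin.toℕ-fromℕ< j<n) smoothed₂

  Columns : ℕ → Pred (Cell n) 0ℓ
  Columns i (x , y) = toℕ x ℕ.< i

  -- Left of column `i` no value changes, and preimages are exchanged only between `i` and `k`, both
  -- further right. In column `i` the value becomes `j`, which leaves exactly the crossings above
  -- row `j`. Hence the set of smoothed crossings stays correct under the switch.
  switch-smoothed : ∀ {τ : Permutation′ n} {i j x y} → (i , j) ∈ Cr τ →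
    let τ′ = switch τ (i , j) in
    ((x , y) ∈ Cr τ × (x , y) ∈ Before i (suc (toℕ j)) →
     (x , y) ∈ Cr τ′ × (x , y) ∈ Columns (suc (toℕ i))) ×
    ((x , y) ∈ Cr τ′ × (x , y) ∈ Columns (suc (toℕ i)) →
     (x , y) ∈ Cr τ × (x , y) ∈ Before i (suc (toℕ j)))
  switch-smoothed {τ} {i} {j} {x} {y} cr@(τi<j , i<k) = to , from
    where
    τ′ = switch τ (i , j)
    k = τ ⟨$⟩ˡ j
    z = τ ⟨$⟩ˡ y
    τz≡y : τ ⟨$⟩ʳ z ≡ y
    τz≡y = Perm.inverseʳ τ
    y≡j : z ≡ k → y ≡ j
    y≡j z≡k = trans (sym τz≡y) (trans (cong (τ ⟨$⟩ʳ_) z≡k) (Perm.inverseʳ τ))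

    to : _ → _
    to ((τx<y , x<z) , inj₁ x<i) = go (z Fin.≟ i) (z Fin.≟ k) , ℕ.m≤n⇒m≤1+n x<i
      where
      τ′x<y : τ′ ⟨$⟩ʳ x Fin.< y
      τ′x<y = subst (Fin._< y) (sym (switch-other τ i j (Fin.<⇒≢ x<i)
                (Fin.<⇒≢ (Fin.<-trans x<i i<k)))) τx<y
      go : _ → _ → (x , y) ∈ Cr τ′
      go (yes z≡i) _ = crossing τ′
        (trans (switch-σ⁻¹j τ i j) (trans (cong (τ ⟨$⟩ʳ_) (sym z≡i)) τz≡y))
        (Fin.<-trans x<i i<k) τ′x<y
      go (no _) (yes z≡k) = crossing τ′ (trans (switch-i τ i j) (sym (y≡j z≡k))) x<i τ′x<y
      go (no z≢i) (no z≢k) = crossing τ′ (trans (switch-other τ i j z≢i z≢k) τz≡y) x<z τ′x<y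
    to ((τx<y , x<z) , inj₂ (refl , j<y)) =
      crossing τ′ (trans (switch-other τ i j (Fin.<⇒≢ x<z ∘ sym)
          (λ z≡k → ℕ.<-irrefl (cong toℕ (sym (y≡j z≡k))) j<y)) τz≡y)
        x<z (subst (Fin._< y) (sym (switch-i τ i j)) j<y) , ℕ.≤-refl

    from : _ → _
    from (cr′@(τ′x<y , _) , s≤s-x≤i) = crτ , before
      where
      x≤i : x Fin.≤ i
      x≤i = ℕ.≤-pred s≤s-x≤i
      before : (x , y) ∈ Before i (suc (toℕ j))
      before with ℕ.m≤n⇒m<n∨m≡n x≤i
      ... | inj₁ x<i = inj₁ x<i
      ... | inj₂ x≡i with refl ← Fin.toℕ-injective x≡i =
        inj₂ (refl , subst (Fin._< y) (switch-i τ i j) τ′x<y)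
      crτ : (x , y) ∈ Cr τ
      crτ with switch-crossing τ cr cr′
      ... | inj₁ c = c
      ... | inj₂ (i≤x , y≤j) with refl ← Fin.≤-antisym x≤i i≤x =
        contradiction (subst (Fin._< y) (switch-i τ i j) τ′x<y) (ℕ.≤⇒≯ y≤j)

  columns⇒before : ∀ {g} {i : Fin n} → SmoothedOn (Columns (toℕ i)) g → SmoothedOn (Before i n) g
  columns⇒before {g} {i} smoothed c = to , from
    where
    to : c ∈ E g → c ∈ Cr (σ g) × c ∈ Before i n
    to e = let cr , x<i = proj₁ (smoothed c) e in cr , inj₁ x<i
    from : c ∈ Cr (σ g) → c ∈ Before i n → c ∈ E g
    from cr (inj₁ x<i)       = proj₂ (smoothed c) cr x<i
    from cr (inj₂ (_ , n≤y)) = contradiction n≤y (ℕ.<⇒≱ (Fin.toℕ<n (proj₂ c)))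

-- Tame permutations are web permutations

module _ {n : ℕ} {π : Permutation′ n} (tame : Tame π) where

  record Stage (i : ℕ) : Set₁ where
    field
      config    : Config n
      reachable : initial n ⟶* config
      smoothed  : SmoothedOn (Columns i) config
      final     : ∀ {x} → toℕ x ℕ.< i → σ config ⟨$⟩ʳ x ≡ π ⟨$⟩ʳ x
      -- The current value at a column x ≥ i is found by following π backwards from x
      -- through columns smaller than i, as far as possible.
      pending   : ∀ {x} → i ℕ.≤ toℕ x →
                  Path (π ⟨$⟩ʳ_) (λ y → toℕ y ℕ.< i) (σ config ⟨$⟩ʳ x) x

  open Stage

  first-stage : Stage 0
  first-stage = record
    { config    = initial n
    ; reachable = ε
    ; smoothed  = λ _ → (λ ()) , λ _ ()
    ; final     = λ ()
    ; pending   = λ _ → []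
    }

  -- First the cells of column `i` above row `j` are smoothed. Tameness gives `τ i ≤ j`: if the
  -- inequality is strict, `(i , j)` is now a maximal crossing and is switched; if `τ i ≡ j`, every
  -- crossing of column `i` has been smoothed.
  next-stage : ∀ (i : Fin n) → Stage (toℕ i) → Stage (suc (toℕ i))
  next-stage i stage
    with h , path , refl , smoothed-h ←
      smooth-above {i = i} (n ℕ.∸ suc (toℕ (π ⟨$⟩ʳ i))) (suc (toℕ (π ⟨$⟩ʳ i)))
        {stage .config} (ℕ.m∸n+n≡m (Fin.toℕ<n (π ⟨$⟩ʳ i)))
        (columns⇒before {g = stage .config} (stage .smoothed))
    = go (ℕ.m≤n⇒m<n∨m≡n τi≤j)
    where
    τ = σ h
    j = π ⟨$⟩ʳ i
    k = τ ⟨$⟩ˡ j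
    reach : initial n ⟶* h
    reach = stage .reachable ◅◅ path
    τk≡j : τ ⟨$⟩ʳ k ≡ j
    τk≡j = Perm.inverseʳ τ
    -- A column `z` left of `i` with `π z ≡ τ i` would also have the current value `τ i`. So the
    -- pending path to `i` cannot be prolonged backwards, as `start≤target` requires.
    unused : ∀ {z} → π ⟨$⟩ʳ z ≡ τ ⟨$⟩ʳ i → toℕ i ℕ.≤ toℕ z
    unused {z} eq with z Fin.<? i
    ... | yes z<i = contradiction (⟨$⟩ʳ-injective τ (trans (stage .final z<i) eq)) (Fin.<⇒≢ z<i)
    ... | no  z≮i = ℕ.≮⇒≥ z≮i
    τi≤j : τ ⟨$⟩ʳ i Fin.≤ j
    τi≤j = start≤target {σ = π} tame unused (stage .pending ℕ.≤-refl) ℕ.≤-refl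
    i<k : τ ⟨$⟩ʳ i Fin.< j → i Fin.< k
    i<k τi<j with Fin.<-cmp i k
    ... | tri< i<k _ _ = i<k
    ... | tri≈ _ i≡k _ = contradiction (trans (cong (τ ⟨$⟩ʳ_) i≡k) τk≡j) (Fin.<⇒≢ τi<j)
    ... | tri> _ _ k<i = contradiction
      (⟨$⟩ʳ-injective π (trans (sym (stage .final k<i)) τk≡j)) (Fin.<⇒≢ k<i)

    go : τ ⟨$⟩ʳ i Fin.< j ⊎ toℕ (τ ⟨$⟩ʳ i) ≡ toℕ j → Stage (suc (toℕ i))
    go (inj₁ τi<j) = record
      { config    = G (switch τ (i , j)) (E h) E⊆
      ; reachable = reach ◅◅ switching (first-maximal {g = h} smoothed-h cr) E⊆ ◅ ε
      ; smoothed  = λ c →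
          (λ e → proj₁ (switch-smoothed {τ = τ} cr) (proj₁ (smoothed-h _) e)) ,
          λ cr′ col → let cr″ , before = proj₂ (switch-smoothed {τ = τ} cr) (cr′ , col)
                      in proj₂ (smoothed-h _) cr″ before
      ; final     = fin
      ; pending   = pend
      }
      where
      cr : (i , j) ∈ Cr τ
      cr = τi<j , i<k τi<j
      E⊆ : ∀ {c} → c ∈ E h → c ∈ Cr (switch τ (i , j))
      E⊆ e = proj₁ (proj₁ (switch-smoothed {τ = τ} cr) (proj₁ (smoothed-h _) e))
      fin : ∀ {x} → toℕ x ℕ.< suc (toℕ i) → switch τ (i , j) ⟨$⟩ʳ x ≡ π ⟨$⟩ʳ x
      fin {x} x<1+i with ℕ.m<1+n⇒m<n∨m≡n x<1+i
      ... | inj₁ x<i = trans (switch-other τ i j (Fin.<⇒≢ x<i)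
                         (Fin.<⇒≢ (Fin.<-trans x<i (i<k τi<j)))) (stage .final x<i)
      ... | inj₂ x≡i with refl ← Fin.toℕ-injective x≡i = switch-i τ i j
      weaken : ∀ {s x} → Path (π ⟨$⟩ʳ_) (λ y → toℕ y ℕ.< toℕ i) s x →
               Path (π ⟨$⟩ʳ_) (λ y → toℕ y ℕ.< suc (toℕ i)) s x
      weaken = mapPath λ y<i → ℕ.m≤n⇒m≤1+n y<i , refl
      pend : ∀ {x} → suc (toℕ i) ℕ.≤ toℕ x →
             Path (π ⟨$⟩ʳ_) (λ y → toℕ y ℕ.< suc (toℕ i)) (switch τ (i , j) ⟨$⟩ʳ x) x
      pend {x} i<x with x Fin.≟ k
      -- The switch gives `k` the value `τ i`: from there `π` leads to `i`, then to `j ≡ τ k`, and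
      -- on to `k` along its old pending path.
      ... | yes refl = start-from (sym (switch-σ⁻¹j τ i j))
        (step (weaken (stage .pending ℕ.≤-refl)) ℕ.≤-refl (sym τk≡j) ++
         weaken (stage .pending (ℕ.<⇒≤ i<x)))
      ... | no x≢k = start-from (sym (switch-other τ i j (Fin.<⇒≢ i<x ∘ sym) x≢k))
        (weaken (stage .pending (ℕ.<⇒≤ i<x)))
    go (inj₂ τi≡j) = record
      { config    = h
      ; reachable = reach
      ; smoothed  = λ c → to c , from c
      ; final     = fin
      ; pending   = λ i<x → mapPath (λ y<i → ℕ.m≤n⇒m≤1+n y<i , refl) (stage .pending (ℕ.<⇒≤ i<x))
      }
      where
      to : ∀ c → c ∈ E h → c ∈ Cr τ × c ∈ Columns (suc (toℕ i))
      to c e with proj₁ (smoothed-h _) e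
      ... | cr , inj₁ x<i        = cr , ℕ.m≤n⇒m≤1+n x<i
      ... | cr , inj₂ (refl , _) = cr , ℕ.≤-refl
      from : ∀ c → c ∈ Cr τ → c ∈ Columns (suc (toℕ i)) → c ∈ E h
      from c cr@(τx<y , _) x<1+i with ℕ.m<1+n⇒m<n∨m≡n x<1+i
      ... | inj₁ x<i = proj₂ (smoothed-h _) cr (inj₁ x<i)
      ... | inj₂ x≡i with refl ← Fin.toℕ-injective x≡i =
        proj₂ (smoothed-h _) cr (inj₂ (refl , subst (ℕ._< toℕ (proj₂ c)) τi≡j τx<y))
      fin : ∀ {x} → toℕ x ℕ.< suc (toℕ i) → τ ⟨$⟩ʳ x ≡ π ⟨$⟩ʳ x
      fin {x} x<1+i with ℕ.m<1+n⇒m<n∨m≡n x<1+i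
      ... | inj₁ x<i = stage .final x<i
      ... | inj₂ x≡i with refl ← Fin.toℕ-injective x≡i = Fin.toℕ-injective τi≡j

  stages : ∀ i → i ℕ.≤ n → Stage i
  stages zero    _   = first-stage
  stages (suc i) i<n = subst (Stage ∘ suc) (Fin.toℕ-fromℕ< i<n)
    (next-stage (fromℕ< i<n) (subst Stage (sym (Fin.toℕ-fromℕ< i<n)) (stages i (ℕ.<⇒≤ i<n))))

  Tame⇒IsWeb : IsWeb π
  Tame⇒IsWeb = let s = stages n ℕ.≤-refl in
    s .config , s .reachable , (λ {c} cr → proj₂ (s .smoothed c) cr (Fin.toℕ<n (proj₁ c))) ,
    λ x → s .final (Fin.toℕ<n x)

-- Tame permutations as histories of open paths

-- Unordered pairs of elements of Fin m, the two elements being allowed to coincide.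
data Pair : ℕ → Set where
  here  : ∀ {m} → Fin (suc m) → Pair (suc m)
  there : ∀ {m} → Pair m → Pair (suc m)

ends : ∀ {m} → Pair m → Fin m × Fin m
ends (here y)  = zero , y
ends (there p) = Product.map suc suc (ends p)

ends-≤ : ∀ {m} (p : Pair m) → proj₁ (ends p) Fin.≤ proj₂ (ends p)
ends-≤ (here y)  = ℕ.z≤n
ends-≤ (there p) = ℕ.s≤s (ends-≤ p)

ends-injective : ∀ {m} (p q : Pair m) → ends p ≡ ends q → p ≡ q
ends-injective (here y)  (here z)  eq = cong (here ∘ proj₂) eq
ends-injective (there p) (there q) eq = cong there (ends-injective p q
  (cong₂ _,_ (Fin.suc-injective (cong proj₁ eq)) (Fin.suc-injective (cong proj₂ eq))))
ends-injective (here _)  (there _) ()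
ends-injective (there _) (here _)  ()

ends-surjective : ∀ {m} (x y : Fin m) → x Fin.≤ y → ∃ λ p → ends p ≡ (x , y)
ends-surjective zero    y       _           = here y , refl
ends-surjective (suc x) (suc y) (ℕ.s≤s x≤y) =
  let p , eq = ends-surjective x y x≤y in there p , cong (Product.map suc suc) eq

ends-swap : ∀ {m} (p q : Pair m) → ends p ≡ Product.swap (ends q) → ends p ≡ ends q
ends-swap p q eq = cong₂ _,_ (trans x≡y (cong proj₂ eq)) (trans (sym x≡y) (cong proj₁ eq))
  where
  x≡y : proj₁ (ends p) ≡ proj₂ (ends p)
  x≡y = Fin.≤-antisym (ends-≤ p)
    (subst₂ Fin._≤_ (sym (cong proj₂ eq)) (sym (cong proj₁ eq)) (ends-≤ q))

module _ {n m : ℕ} (s : Fin m → Fin n) where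

  sortBy : Fin m × Fin m → Fin m × Fin m
  sortBy (x , y) with s x Fin.≤? s y
  ... | yes _ = x , y
  ... | no  _ = y , x

  orient : Pair m → Fin m × Fin m
  orient = sortBy ∘ ends

  sortBy-≤ : ∀ xy → s (proj₁ (sortBy xy)) Fin.≤ s (proj₂ (sortBy xy))
  sortBy-≤ (x , y) with s x Fin.≤? s y
  ... | yes sx≤sy = sx≤sy
  ... | no  sx≰sy = ℕ.≰⇒≥ sx≰sy

  sortBy-cases : ∀ xy → sortBy xy ≡ xy ⊎ sortBy xy ≡ Product.swap xy
  sortBy-cases (x , y) with s x Fin.≤? s y
  ... | yes _ = inj₁ refl
  ... | no  _ = inj₂ refl

  sortBy-fix : ∀ {x y} → s x Fin.≤ s y → sortBy (x , y) ≡ (x , y)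
  sortBy-fix {x} {y} sx≤sy with s x Fin.≤? s y
  ... | yes _     = refl
  ... | no  sx≰sy = contradiction sx≤sy sx≰sy

  orient-injective : ∀ p q → orient p ≡ orient q → p ≡ q
  orient-injective p q eq with sortBy-cases (ends p) | sortBy-cases (ends q)
  ... | inj₁ p≡ | inj₁ q≡ = ends-injective p q (trans (sym p≡) (trans eq q≡))
  ... | inj₁ p≡ | inj₂ q≡ = ends-injective p q (ends-swap p q (trans (sym p≡) (trans eq q≡)))
  ... | inj₂ p≡ | inj₁ q≡ =
    ends-injective p q (sym (ends-swap q p (trans (sym q≡) (trans (sym eq) p≡))))
  ... | inj₂ p≡ | inj₂ q≡ =
    ends-injective p q (cong Product.swap (trans (sym p≡) (trans eq q≡)))

  orient-surjective : (∀ {x y} → s x ≡ s y → x ≡ y) → ∀ {x y} → s x Fin.≤ s y →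
                      ∃ λ p → orient p ≡ (x , y)
  orient-surjective s-injective {x} {y} sx≤sy with Fin.≤-total x y
  ... | inj₁ x≤y = let p , eq = ends-surjective x y x≤y in
    p , trans (cong sortBy eq) (sortBy-fix sx≤sy)
  ... | inj₂ y≤x = let p , eq = ends-surjective y x y≤x in
    p , trans (cong sortBy eq) swapped
    where
    swapped : sortBy (y , x) ≡ (x , y)
    swapped with s y Fin.≤? s x
    ... | no _      = refl
    -- The values tie, so injectivity of `s` makes `x` and `y` equal.
    ... | yes sy≤sx with refl ← s-injective (Fin.≤-antisym sx≤sy sy≤sx) = refl

-- Makes x lead to the start σ y of the orbit segment that ends at y.
freeze : ∀ {n} → Permutation′ n → Fin n → Fin n → Permutation′ n
freeze σ x y = switch σ (x , σ ⟨$⟩ʳ y)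

module _ {n : ℕ} (σ : Permutation′ n) (x y : Fin n) where

  freeze-source : freeze σ x y ⟨$⟩ʳ x ≡ σ ⟨$⟩ʳ y
  freeze-source = switch-i σ x _

  freeze-target : freeze σ x y ⟨$⟩ʳ y ≡ σ ⟨$⟩ʳ x
  freeze-target = trans (cong (freeze σ x y ⟨$⟩ʳ_) (sym (Perm.inverseˡ σ))) (switch-σ⁻¹j σ x _)

  freeze-other : ∀ {z} → z ≢ x → z ≢ y → freeze σ x y ⟨$⟩ʳ z ≡ σ ⟨$⟩ʳ z
  freeze-other z≢x z≢y = switch-other σ x _ z≢x (z≢y ∘ flip trans (Perm.inverseˡ σ))

removeAt-elim : ∀ {A : Set} {P : Pred A 0ℓ} {m} (e : Vector A (suc m)) k →
                P (e k) → (∀ l → P (removeAt e k l)) → ∀ l → P (e l)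
removeAt-elim {P = P} e k pk prest l with k Fin.≟ l
... | yes refl = pk
... | no  k≢l  = subst (P ∘ e) (Fin.punchIn-punchOut k≢l) (prest (punchOut k≢l))

-- Choice m m′: what happens at a new point i when m paths are open and m′ paths are
-- open afterwards.  Either i starts a path, or is a fixed point, or prolongs path k
-- and stays open, or prolongs a path and leads to the start of a path.  In the last
-- case the pair consists of the two paths, the one with the smaller start being the
-- one that i prolongs; if they coincide, the path becomes a cycle.
data Choice : ℕ → ℕ → Set where
  start : ∀ {m} → Choice m (suc m)
  fix   : ∀ {m} → Choice m m
  pass  : ∀ {m} → Fin (suc m) → Choice (suc m) (suc m)
  close : ∀ {m} → Pair (suc m) → Choice (suc m) m

infixr 5 _∷_

-- A history of the last `r` points when `m` paths are open: a Motzkin path with coloured steps from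
-- height `m` to height 0, so that no path remains open.
data Code : ℕ → ℕ → Set where
  stop : Code 0 0
  _∷_  : ∀ {r m m′} → Choice m m′ → Code r m′ → Code (suc r) m

module _ {n : ℕ} where

  Frozen : ∀ {m} → ℕ → Vector (Fin n) m → Pred (Fin n) 0ℓ
  Frozen t e x = toℕ x ℕ.< t × ∀ k → e k ≢ x

  -- The points smaller than t have been treated, and e lists the ends of the open
  -- paths.  The permutation σ closes them up: path k runs from σ (e k) to e k.
  record Valid {m} (t : ℕ) (σ : Permutation′ n) (e : Vector (Fin n) m) : Set where
    field
      started  : ∀ k → toℕ (e k) ℕ.< t
      distinct : ∀ {k l} → e k ≡ e l → k ≡ l
      fixed    : ∀ {x} → t ℕ.≤ toℕ x → σ ⟨$⟩ʳ x ≡ x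
      path     : ∀ k → Path (σ ⟨$⟩ʳ_) (Frozen t e) (σ ⟨$⟩ʳ e k) (e k)

  Agrees : ∀ {m} → ℕ → Permutation′ n → Vector (Fin n) m → Permutation′ n → Set
  Agrees t σ e π = ∀ {x} → x ∈ Frozen t e → π ⟨$⟩ʳ x ≡ σ ⟨$⟩ʳ x

  -- π is a possible outcome: treated points other than the ends of open paths keep
  -- their value, and open paths are continued by later points.
  record Fits {m} (t : ℕ) (σ : Permutation′ n) (e : Vector (Fin n) m) (π : Permutation′ n) : Set where
    field
      agrees : Agrees t σ e π
      late   : ∀ k → t ℕ.≤ toℕ (π ⟨$⟩ʳ e k)

  open Valid
  open Fits

  module _ {m t : ℕ} {σ : Permutation′ n} {e : Vector (Fin n) m} {i : Fin n}
           (valid : Valid t σ e) (i≡t : toℕ i ≡ t) where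

    fixed-i : σ ⟨$⟩ʳ i ≡ i
    fixed-i = valid .fixed (ℕ.≤-reflexive (sym i≡t))

    e≢i : ∀ k → e k ≢ i
    e≢i k ek≡i = ℕ.<-irrefl (trans (cong toℕ ek≡i) i≡t) (valid .started k)

    Frozen-◂ : ∀ {x} → x ∈ Frozen t e → x ∈ Frozen (suc t) (i ◂ e)
    Frozen-◂ (x<t , x∉e) = ℕ.m≤n⇒m≤1+n x<t , λ
      { zero    i≡x → ℕ.<-irrefl (trans (cong toℕ (sym i≡x)) i≡t) x<t
      ; (suc k) → x∉e k }

    Frozen-◂⁻ : ∀ {x} → x ∈ Frozen (suc t) (i ◂ e) → x ∈ Frozen t e
    Frozen-◂⁻ (x<1+t , x∉) with ℕ.m<1+n⇒m<n∨m≡n x<1+t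
    ... | inj₁ x<t = x<t , x∉ ∘ suc
    ... | inj₂ x≡t = contradiction (Fin.toℕ-injective (trans i≡t (sym x≡t))) (x∉ zero)

    start-valid : Valid (suc t) σ (i ◂ e)
    start-valid .started zero    = ℕ.≤-reflexive (cong suc i≡t)
    start-valid .started (suc k) = ℕ.m≤n⇒m≤1+n (valid .started k)
    start-valid .distinct {zero}  {zero}  _  = refl
    start-valid .distinct {zero}  {suc l} eq = contradiction (sym eq) (e≢i l)
    start-valid .distinct {suc k} {zero}  eq = contradiction eq (e≢i k)
    start-valid .distinct {suc k} {suc l} eq = cong suc (valid .distinct eq)
    start-valid .fixed t<x = valid .fixed (ℕ.<⇒≤ t<x)
    start-valid .path zero    = start-from (sym fixed-i) []
    start-valid .path (suc k) = mapPath (λ fr → Frozen-◂ fr , refl) (valid .path k)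

    image-< : ∀ {x} → toℕ x ℕ.< t → toℕ (σ ⟨$⟩ʳ x) ℕ.< t
    image-< {x} x<t with toℕ (σ ⟨$⟩ʳ x) ℕ.<? t
    ... | yes σx<t = σx<t
    ... | no  σx≮t = contradiction
      (subst (λ y → toℕ y ℕ.< t) (sym (⟨$⟩ʳ-injective σ (valid .fixed (ℕ.≮⇒≥ σx≮t)))) x<t) σx≮t

  module _ {m t : ℕ} {σ : Permutation′ n} {e : Vector (Fin n) (suc m)}
           (valid : Valid t σ e) (k b : Fin (suc m)) where

    Frozen-removeAt : ∀ {x} → x ∈ Frozen t e → x ∈ Frozen t (removeAt e k)
    Frozen-removeAt (x<t , x∉e) = x<t , x∉e ∘ punchIn k

    removed-frozen : e k ∈ Frozen t (removeAt e k)
    removed-frozen = valid .started k , λ l eq → Fin.punchInᵢ≢i k l (valid .distinct eq)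

    Frozen-unmoved : ∀ {x} → x ∈ Frozen t e → freeze σ (e k) (e b) ⟨$⟩ʳ x ≡ σ ⟨$⟩ʳ x
    Frozen-unmoved (_ , x∉e) = freeze-other σ (e k) (e b) (x∉e k ∘ sym) (x∉e b ∘ sym)

    -- Freezing `e k` onto the start of path `b` puts path `k` in front of path `b`, whose end stays
    -- open. For `k ≡ b` the values of `σ` do not change and the path drops out as a cycle.
    freeze-valid : Valid t (freeze σ (e k) (e b)) (removeAt e k)
    freeze-valid .started l    = valid .started (punchIn k l)
    freeze-valid .distinct eq  = Fin.punchIn-injective k _ _ (valid .distinct eq)
    freeze-valid .fixed {x} t≤x =
      trans (freeze-other σ (e k) (e b) (x≢e k) (x≢e b)) (valid .fixed t≤x)
      where
      x≢e : ∀ l → x ≢ e l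
      x≢e l refl = ℕ.<⇒≱ (valid .started l) t≤x
    freeze-valid .path l = go (punchIn k l Fin.≟ b)
      where
      f′ = freeze σ (e k) (e b) ⟨$⟩ʳ_
      lift : ∀ {x y} → Path (σ ⟨$⟩ʳ_) (Frozen t e) x y → Path f′ (Frozen t (removeAt e k)) x y
      lift = mapPath λ fr → Frozen-removeAt fr , Frozen-unmoved fr
      go : Dec (punchIn k l ≡ b) →
           Path f′ (Frozen t (removeAt e k)) (f′ (removeAt e k l)) (removeAt e k l)
      go (yes l≡b) = start-from (sym (trans (cong (f′ ∘ e) l≡b) (freeze-target σ (e k) (e b))))
        (step (lift (valid .path k)) removed-frozen
           (trans (freeze-source σ (e k) (e b)) (cong (λ x → σ ⟨$⟩ʳ e x) (sym l≡b)))
         ++ lift (valid .path (punchIn k l)))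
      go (no l≢b) = start-from
        (sym (freeze-other σ (e k) (e b) (Fin.punchInᵢ≢i k l ∘ valid .distinct)
          (l≢b ∘ valid .distinct)))
        (lift (valid .path (punchIn k l)))

    unfreeze-agrees : ∀ {π} → Agrees t (freeze σ (e k) (e b)) (removeAt e k) π →
                      Agrees t σ e π × π ⟨$⟩ʳ e k ≡ σ ⟨$⟩ʳ e b
    unfreeze-agrees agrees = (λ fr → trans (agrees (Frozen-removeAt fr)) (Frozen-unmoved fr)) ,
      trans (agrees removed-frozen) (freeze-source σ (e k) (e b))

    freeze-agrees : ∀ {π} → Agrees t σ e π → π ⟨$⟩ʳ e k ≡ σ ⟨$⟩ʳ e b →
                    Agrees t (freeze σ (e k) (e b)) (removeAt e k) π
    freeze-agrees agrees πek≡σeb {x} (x<t , x∉) with e k Fin.≟ x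
    ... | yes refl = trans πek≡σeb (sym (freeze-source σ (e k) (e b)))
    ... | no ek≢x  = trans (agrees fr) (sym (Frozen-unmoved fr))
      where
      fr : x ∈ Frozen t e
      fr = x<t , removeAt-elim {P = _≢ x} e k ek≢x x∉

  closing : ∀ {m} → Permutation′ n → Vector (Fin n) m → Pair m → Fin m × Fin m
  closing σ e = orient (λ k → σ ⟨$⟩ʳ e k)

  -- Every choice amounts to starting a path at `i` and then freezing, so that `start-valid` and
  -- `freeze-valid` cover all cases. `fix` closes the new path at once, `pass k` puts path `k` in
  -- front of it, and `close` puts `i` in front of path `b` and then path `k` in front of that.
  next-σ : ∀ {m m′} → Choice m m′ → Fin n → Permutation′ n → Vector (Fin n) m → Permutation′ n
  next-σ start     i σ e = σ
  next-σ fix       i σ e = freeze σ i i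
  next-σ (pass k)  i σ e = freeze σ (e k) i
  next-σ (close p) i σ e = let k , b = closing σ e p in freeze (freeze σ i (e b)) (e k) (e b)

  next-e : ∀ {m m′} → Choice m m′ → Fin n → Permutation′ n → Vector (Fin n) m → Vector (Fin n) m′
  next-e start     i σ e = i ◂ e
  next-e fix       i σ e = e
  next-e (pass k)  i σ e = removeAt (i ◂ e) (suc k)
  next-e (close p) i σ e = removeAt e (proj₁ (closing σ e p))

  -- The trace that the choice made at i leaves in the outcome π.
  Key : ∀ {m m′} → Choice m m′ → Fin n → Permutation′ n → Vector (Fin n) m → Permutation′ n → Set
  Key start     i σ e π = (∀ k → π ⟨$⟩ʳ e k ≢ i) × i Fin.< π ⟨$⟩ʳ i
  Key fix       i σ e π = (∀ k → π ⟨$⟩ʳ e k ≢ i) × π ⟨$⟩ʳ i ≡ i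
  Key (pass k)  i σ e π = π ⟨$⟩ʳ e k ≡ i × i Fin.< π ⟨$⟩ʳ i
  Key (close p) i σ e π = let k , b = closing σ e p in π ⟨$⟩ʳ e k ≡ i × π ⟨$⟩ʳ i ≡ σ ⟨$⟩ʳ e b

  module _ {m t : ℕ} {σ : Permutation′ n} {e : Vector (Fin n) m} {i : Fin n}
           (valid : Valid t σ e) (i≡t : toℕ i ≡ t) where

    next-valid : ∀ {m′} (ch : Choice m m′) → Valid (suc t) (next-σ ch i σ e) (next-e ch i σ e)
    next-valid start     = start-valid valid i≡t
    next-valid fix       = freeze-valid (start-valid valid i≡t) zero zero
    next-valid (pass k)  = freeze-valid (start-valid valid i≡t) (suc k) zero
    next-valid (close p) = let k , b = closing σ e p in
      freeze-valid (freeze-valid (start-valid valid i≡t) zero (suc b)) k b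

    private
      after-i : ∀ {x : Fin n} → suc t ℕ.≤ toℕ x → i Fin.< x
      after-i = subst (λ s → suc s ℕ.≤ _) (sym i≡t)

      from-i : ∀ {x : Fin n} → x ≡ i → t ℕ.≤ toℕ x
      from-i x≡i = ℕ.≤-reflexive (trans (sym i≡t) (cong toℕ (sym x≡i)))

      misses-i : ∀ {x : Fin n} → suc t ℕ.≤ toℕ x → x ≢ i
      misses-i t<x x≡i = ℕ.<⇒≢ (after-i t<x) (cong toℕ (sym x≡i))

      ◂-agrees : ∀ {π} → Agrees (suc t) σ (i ◂ e) π → Agrees t σ e π
      ◂-agrees agrees = agrees ∘ Frozen-◂ valid i≡t

    -- Undoing the freezes recovers the values of `π` that the choice has fixed. The end whose path
    -- `i` prolongs has value `i` under `π`, late enough for the earlier stage because `i` is the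
    -- point `t`.
    fits-previous : ∀ {m′} (ch : Choice m m′) {π} →
                    Fits (suc t) (next-σ ch i σ e) (next-e ch i σ e) π →
                    Fits t σ e π × Key ch i σ e π
    fits-previous start {π} fits =
      record { agrees = ◂-agrees {π} (fits .agrees) ; late = λ k → ℕ.<⇒≤ (fits .late (suc k)) } ,
      (λ k → misses-i (fits .late (suc k))) , after-i (fits .late zero)
    fits-previous fix {π} fits =
      let agr , πi≡σi = unfreeze-agrees (start-valid valid i≡t) zero zero {π} (fits .agrees)
      in record { agrees = ◂-agrees {π} agr ; late = λ k → ℕ.<⇒≤ (fits .late k) } ,
         (λ k → misses-i (fits .late k)) , trans πi≡σi (fixed-i valid i≡t)
    fits-previous (pass k) {π} fits =
      let agr , πek≡σi = unfreeze-agrees (start-valid valid i≡t) (suc k) zero {π} (fits .agrees)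
          πek≡i = trans πek≡σi (fixed-i valid i≡t)
      in record
           { agrees = ◂-agrees {π} agr
           ; late   = removeAt-elim {P = λ x → t ℕ.≤ toℕ (π ⟨$⟩ʳ x)} e k
               (from-i πek≡i) (λ l → ℕ.<⇒≤ (fits .late (suc l)))
           } ,
         πek≡i , after-i (fits .late zero)
    fits-previous (close p) {π} fits =
      let k , b = closing σ e p
          valid₀ = start-valid valid i≡t
          agr₁ , πek≡ = unfreeze-agrees (freeze-valid valid₀ zero (suc b)) k b {π} (fits .agrees)
          agr , πi≡σeb = unfreeze-agrees valid₀ zero (suc b) {π} agr₁
          πek≡i = trans πek≡ (trans (freeze-target σ i (e b)) (fixed-i valid i≡t))
      in record
           { agrees = ◂-agrees {π} agr
           ; late   = removeAt-elim {P = λ x → t ℕ.≤ toℕ (π ⟨$⟩ʳ x)} e k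
               (from-i πek≡i) (λ l → ℕ.<⇒≤ (fits .late l))
           } ,
         πek≡i , πi≡σeb

    fits-next : ∀ {m′} (ch : Choice m m′) {π} → Fits t σ e π → Key ch i σ e π →
                Fits (suc t) (next-σ ch i σ e) (next-e ch i σ e) π
    fits-next ch {π} fits = go ch
      where
      agr : Agrees (suc t) σ (i ◂ e) π
      agr = fits .agrees ∘ Frozen-◂⁻ valid i≡t
      late⁺ : ∀ {k} → π ⟨$⟩ʳ e k ≢ i → suc t ℕ.≤ toℕ (π ⟨$⟩ʳ e k)
      late⁺ {k} πek≢i = ℕ.≤∧≢⇒< (fits .late k)
        (λ t≡ → πek≢i (Fin.toℕ-injective (trans (sym t≡) (sym i≡t))))
      late-i : i Fin.< π ⟨$⟩ʳ i → suc t ℕ.≤ toℕ (π ⟨$⟩ʳ i)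
      late-i = subst (λ s → suc s ℕ.≤ _) i≡t
      -- By injectivity only one end is sent to `i`, so the ends that stay open have values beyond
      -- `t`.
      others : ∀ {k l} → π ⟨$⟩ʳ e k ≡ i → l ≢ k → suc t ℕ.≤ toℕ (π ⟨$⟩ʳ e l)
      others πek≡i l≢k = late⁺ λ πel≡i →
        l≢k (valid .distinct (⟨$⟩ʳ-injective π (trans πel≡i (sym πek≡i))))

      go : ∀ {m′} (ch : Choice m m′) → Key ch i σ e π →
           Fits (suc t) (next-σ ch i σ e) (next-e ch i σ e) π
      go start (none , i<πi) = record
        { agrees = agr ; late = λ { zero → late-i i<πi ; (suc k) → late⁺ (none k) } }
      go fix (none , πi≡i) = record
        { agrees = freeze-agrees (start-valid valid i≡t) zero zero {π} agr
            (trans πi≡i (sym (fixed-i valid i≡t)))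
        ; late   = λ k → late⁺ (none k) }
      go (pass k) (πek≡i , i<πi) = record
        { agrees = freeze-agrees (start-valid valid i≡t) (suc k) zero {π} agr
            (trans πek≡i (sym (fixed-i valid i≡t)))
        ; late   = λ { zero → late-i i<πi ; (suc l) → others πek≡i (Fin.punchInᵢ≢i k l) } }
      go (close p) (πek≡i , πi≡σeb) =
        let k , b = closing σ e p
            valid₀ = start-valid valid i≡t
        in record
        { agrees = freeze-agrees (freeze-valid valid₀ zero (suc b)) k b {π}
            (freeze-agrees valid₀ zero (suc b) {π} agr πi≡σeb)
            (trans πek≡i (sym (trans (freeze-target σ i (e b)) (fixed-i valid i≡t))))
        ; late   = λ l → others πek≡i (Fin.punchInᵢ≢i k l) }

    -- The constructor is determined by whether an open path leads to `i` and by comparing `π i`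
    -- with `i`, since starts of open paths lie below `i`. Injectivity then determines the paths
    -- involved.
    key-unique : ∀ {π m₁ m₂} (ch₁ : Choice m m₁) (ch₂ : Choice m m₂) →
                 Key ch₁ i σ e π → Key ch₂ i σ e π → (m₁ , ch₁) ≡ (m₂ , ch₂)
    key-unique {π} = go
      where
      same-arrival : ∀ {k l} → π ⟨$⟩ʳ e k ≡ i → π ⟨$⟩ʳ e l ≡ i → k ≡ l
      same-arrival p q = valid .distinct (⟨$⟩ʳ-injective π (trans p (sym q)))
      not-fixed : ∀ {k} {A : Set} → π ⟨$⟩ʳ e k ≡ i → π ⟨$⟩ʳ i ≡ i → A
      not-fixed p q = contradiction (⟨$⟩ʳ-injective π (trans p (sym q))) (e≢i valid i≡t _)
      not-early : ∀ {b} {A : Set} → i Fin.< π ⟨$⟩ʳ i → π ⟨$⟩ʳ i ≡ σ ⟨$⟩ʳ e b → A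
      not-early {b} p q = contradiction (subst (toℕ i ℕ.<_) (cong toℕ q) p)
        (ℕ.<⇒≯ (subst (toℕ (σ ⟨$⟩ʳ e b) ℕ.<_) (sym i≡t) (image-< valid i≡t (valid .started b))))
      not-both : ∀ {A : Set} → i Fin.< π ⟨$⟩ʳ i → π ⟨$⟩ʳ i ≡ i → A
      not-both p q = contradiction (cong toℕ (sym q)) (ℕ.<⇒≢ p)

      go : ∀ {m₁ m₂} (ch₁ : Choice m m₁) (ch₂ : Choice m m₂) →
           Key ch₁ i σ e π → Key ch₂ i σ e π → (m₁ , ch₁) ≡ (m₂ , ch₂)
      go start     start     _           _           = refl
      go start     fix       (_ , p)     (_ , q)     = not-both p q
      go start     (pass l)  (p , _)     (q , _)     = contradiction q (p l)
      go start     (close _) (p , _)     (q , _)     = contradiction q (p _)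
      go fix       start     (_ , p)     (_ , q)     = not-both q p
      go fix       fix       _           _           = refl
      go fix       (pass l)  (p , _)     (q , _)     = contradiction q (p l)
      go fix       (close _) (p , _)     (q , _)     = contradiction q (p _)
      go (pass k)  start     (p , _)     (q , _)     = contradiction p (q k)
      go (pass k)  fix       (p , _)     (q , _)     = contradiction p (q k)
      go (pass k)  (pass l)  (p , _)     (q , _)     = cong (λ z → _ , pass z) (same-arrival p q)
      go (pass k)  (close _) (_ , p)     (_ , q)     = not-early p q
      go (close _) start     (p , _)     (q , _)     = contradiction p (q _)
      go (close _) fix       (p , _)     (q , _)     = contradiction p (q _)
      go (close _) (pass l)  (_ , p)     (_ , q)     = not-early q p
      go (close p) (close q) (pk , pb)   (qk , qb)   =
        cong (λ z → _ , close z) (orient-injective (λ k → σ ⟨$⟩ʳ e k) p q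
          (cong₂ _,_ (same-arrival pk qk) (valid .distinct (⟨$⟩ʳ-injective σ (trans (sym pb) qb)))))

    early-agrees : ∀ {π} → Fits t σ e π → ∀ {z} → toℕ z ℕ.< t → toℕ (π ⟨$⟩ʳ z) ℕ.< t →
              π ⟨$⟩ʳ z ≡ σ ⟨$⟩ʳ z
    early-agrees fits {z} z<t πz<t with Fin.any? (λ k → e k Fin.≟ z)
    ... | yes (k , refl) = contradiction πz<t (ℕ.≤⇒≯ (fits .late k))
    ... | no  z∉e        = fits .agrees (z<t , λ k ek≡z → z∉e (k , ek≡z))

    start-path : ∀ {π} → Fits t σ e π → ∀ {k} → π ⟨$⟩ʳ e k ≡ i →
                 Path (π ⟨$⟩ʳ_) (Fin._< i) (σ ⟨$⟩ʳ e k) i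
    start-path fits {k} πek≡i = step
      (mapPath (λ fr → subst (_ ℕ.<_) (sym i≡t) (proj₁ fr) , fits .agrees fr) (valid .path k))
      (subst (_ ℕ.<_) (sym i≡t) (valid .started k)) πek≡i

  -- If no open path leads to `i`, then no smaller point does, and tameness forbids `π i < i`. If
  -- path `k` leads to `i` and `π i < i`, then `π i` is the start of an open path `b`, and tameness
  -- puts the start of path `k` weakly below it.
  key-exists : ∀ {m t σ i π} {e : Vector (Fin n) m} →
               Valid t σ e → toℕ i ≡ t → Tame π → Fits t σ e π →
               ∃₂ λ m′ (ch : Choice m m′) → Key ch i σ e π
  key-exists {m} {t} {σ} {i} {π} {e} valid i≡t tame fits =
    go (Fin.any? (λ k → π ⟨$⟩ʳ e k Fin.≟ i)) (Fin.<-cmp i (π ⟨$⟩ʳ i))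
    where
    at-i : ∀ {u} → u ℕ.< t → u ℕ.< toℕ i
    at-i {u} = subst (u ℕ.<_) (sym i≡t)

    no-drop : (∀ k → π ⟨$⟩ʳ e k ≢ i) → i Fin.≤ π ⟨$⟩ʳ i
    no-drop none = start≤target {σ = π} tame before [] ℕ.≤-refl
      where
      before : ∀ {z} → π ⟨$⟩ʳ z ≡ i → toℕ i ℕ.≤ toℕ z
      before {z} πz≡i with z Fin.<? i
      ... | no  z≮i = ℕ.≮⇒≥ z≮i
      ... | yes z<i = contradiction (⟨$⟩ʳ-injective σ (trans (sym (fits .agrees
          (subst (toℕ z ℕ.<_) i≡t z<i , λ { k refl → none k πz≡i })))
          (trans πz≡i (sym (fixed-i valid i≡t))))) (Fin.<⇒≢ z<i)

    drop : ∀ {k} → π ⟨$⟩ʳ e k ≡ i → π ⟨$⟩ʳ i Fin.< i →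
           ∃ λ b → π ⟨$⟩ʳ i ≡ σ ⟨$⟩ʳ e b × σ ⟨$⟩ʳ e k Fin.≤ σ ⟨$⟩ʳ e b
    drop {k} πek≡i πi<i with Fin.any? (λ b → σ ⟨$⟩ʳ e b Fin.≟ π ⟨$⟩ʳ i)
    ... | yes (b , σeb≡πi) = b , sym σeb≡πi , subst (σ ⟨$⟩ʳ e k Fin.≤_) (sym σeb≡πi)
      (start≤target {σ = π} tame before (start-path valid i≡t fits πek≡i) ℕ.≤-refl)
      where
      -- Only `e k` is sent by `σ` to the start of path `k`, and its value under `π` is late; so no
      -- point below `i` precedes this start in the orbit.
      before : ∀ {z} → π ⟨$⟩ʳ z ≡ σ ⟨$⟩ʳ e k → toℕ i ℕ.≤ toℕ z
      before {z} πz≡ with z Fin.<? i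
      ... | no  z≮i = ℕ.≮⇒≥ z≮i
      ... | yes z<i = contradiction πz<t
        (ℕ.≤⇒≯ (subst (λ y → t ℕ.≤ toℕ (π ⟨$⟩ʳ y)) (sym z≡ek) (fits .late k)))
        where
        z<t = subst (toℕ z ℕ.<_) i≡t z<i
        πz<t : toℕ (π ⟨$⟩ʳ z) ℕ.< t
        πz<t = subst (λ y → toℕ y ℕ.< t) (sym πz≡) (image-< valid i≡t (valid .started k))
        z≡ek : z ≡ e k
        z≡ek = ⟨$⟩ʳ-injective σ (trans (sym (early-agrees valid i≡t fits z<t πz<t)) πz≡)
    -- If no open path starts at `π i`, the preimage `x` of `π i` under `σ` is frozen, so `π` would
    -- take the same value at `x` and at `i`.
    ... | no  unmatched = contradiction
      (⟨$⟩ʳ-injective π (trans (fits .agrees (x<t , x∉e)) σx≡πi)) (Fin.<⇒≢ (at-i x<t))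
      where
      x = σ ⟨$⟩ˡ (π ⟨$⟩ʳ i)
      σx≡πi : σ ⟨$⟩ʳ x ≡ π ⟨$⟩ʳ i
      σx≡πi = Perm.inverseʳ σ
      x<t : toℕ x ℕ.< t
      x<t with toℕ x ℕ.<? t
      ... | yes x<t = x<t
      ... | no  x≮t = contradiction (subst (toℕ (π ⟨$⟩ʳ i) ℕ.<_) i≡t πi<i)
        (subst (λ y → ¬ toℕ y ℕ.< t) (trans (sym (valid .fixed (ℕ.≮⇒≥ x≮t))) σx≡πi) x≮t)
      x∉e : ∀ b → e b ≢ x
      x∉e b eb≡x = unmatched (b , trans (cong (σ ⟨$⟩ʳ_) eb≡x) σx≡πi)

    -- The number of open paths is generalised so that it can be split: an index or a pair forces it
    -- to be a successor, as `pass` and `close` demand.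
    arrival : ∀ {m} {e : Vector (Fin n) m} k → π ⟨$⟩ʳ e k ≡ i → i Fin.< π ⟨$⟩ʳ i →
              ∃₂ λ m′ (ch : Choice m m′) → Key ch i σ e π
    arrival {suc m} k πek≡i i<πi = _ , pass k , πek≡i , i<πi

    closure : ∀ {m} {e : Vector (Fin n) m} (p : Pair m) →
              (let k , b = closing σ e p in π ⟨$⟩ʳ e k ≡ i × π ⟨$⟩ʳ i ≡ σ ⟨$⟩ʳ e b) →
              ∃₂ λ m′ (ch : Choice m m′) → Key ch i σ e π
    closure {suc m} p key = _ , close p , key

    go : _ → _ → _
    go (no none) (tri< i<πi _ _) = _ , start , (λ k πek≡i → none (k , πek≡i)) , i<πi
    go (no none) (tri≈ _ i≡πi _) = _ , fix , (λ k πek≡i → none (k , πek≡i)) , sym i≡πi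
    go (no none) (tri> _ _ πi<i) = contradiction πi<i (ℕ.≤⇒≯ (no-drop λ k πek≡i → none (k , πek≡i)))
    go (yes (k , πek≡i)) (tri< i<πi _ _) = arrival k πek≡i i<πi
    go (yes (k , πek≡i)) (tri≈ _ i≡πi _) =
      contradiction (⟨$⟩ʳ-injective π (trans πek≡i i≡πi)) (e≢i valid i≡t k)
    go (yes (k , πek≡i)) (tri> _ _ πi<i)
      with b , πi≡σeb , σek≤σeb ← drop πek≡i πi<i
      with p , eq ← orient-surjective (λ l → σ ⟨$⟩ʳ e l)
                      (valid .distinct ∘ ⟨$⟩ʳ-injective σ) {k} {b} σek≤σeb
      = closure p (subst (λ (k , b) → π ⟨$⟩ʳ e k ≡ i × π ⟨$⟩ʳ i ≡ σ ⟨$⟩ʳ e b)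
          (sym eq) (πek≡i , πi≡σeb))

  -- Decoding histories into tame permutations

  point : ∀ {r} t → t ℕ.+ suc r ≡ n → Fin n
  point {r} t t+r≡n = fromℕ< (ℕ.≤-trans (ℕ.m≤m+n (suc t) r)
    (ℕ.≤-reflexive (trans (sym (ℕ.+-suc t r)) t+r≡n)))

  toℕ-point : ∀ {r} t (eq : t ℕ.+ suc r ≡ n) → toℕ (point t eq) ≡ t
  toℕ-point t eq = Fin.toℕ-fromℕ< _

  run : ∀ {r m} t → t ℕ.+ r ≡ n → Code r m → Permutation′ n → Vector (Fin n) m → Permutation′ n
  run t eq stop     σ e = σ
  run t eq (ch ∷ c) σ e =
    run (suc t) (trans (sym (ℕ.+-suc t _)) eq) c
      (next-σ ch (point t eq) σ e) (next-e ch (point t eq) σ e)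

  run-fits : ∀ {r m} t eq (c : Code r m) {σ e π} → Valid t σ e →
             run t eq c σ e Perm.≈ π → Fits t σ e π
  run-fits t eq stop     valid run≈π = record { agrees = λ {x} _ → sym (run≈π x) ; late = λ () }
  run-fits t eq (ch ∷ c) {π = π} valid run≈π =
    proj₁ (fits-previous valid (toℕ-point t eq) ch {π}
      (run-fits (suc t) _ c (next-valid valid (toℕ-point t eq) ch) run≈π))

  run-key : ∀ {r m m′} t eq (ch : Choice m m′) (c : Code r m′) {σ e π} → Valid t σ e →
            run t eq (ch ∷ c) σ e Perm.≈ π → Key ch (point t eq) σ e π
  run-key t eq ch c {π = π} valid run≈π =
    proj₂ (fits-previous valid (toℕ-point t eq) ch {π}
      (run-fits (suc t) _ c (next-valid valid (toℕ-point t eq) ch) run≈π))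

  -- The outcome `π` determines the key at each point, hence the choice made there.
  run-injective : ∀ {r m} t eq (c₁ c₂ : Code r m) {σ e π} → Valid t σ e →
                  run t eq c₁ σ e Perm.≈ π → run t eq c₂ σ e Perm.≈ π → c₁ ≡ c₂
  run-injective t eq stop stop _ _ _ = refl
  run-injective t eq (ch₁ ∷ c₁) (ch₂ ∷ c₂) {σ} {e} {π} valid run₁≈π run₂≈π
    with refl ← key-unique valid (toℕ-point t eq) {π} ch₁ ch₂
                  (run-key t eq ch₁ c₁ valid run₁≈π) (run-key t eq ch₂ c₂ valid run₂≈π)
    = cong (ch₁ ∷_) (run-injective (suc t) _ c₁ c₂ {π = π}
        (next-valid valid (toℕ-point t eq) ch₁) run₁≈π run₂≈π)

  run-surjective : ∀ {r m} t eq {σ} {e : Vector (Fin n) m} {π} → Tame π → Valid t σ e → Fits t σ e π →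
                   ∃ λ (c : Code r m) → run t eq c σ e Perm.≈ π
  run-surjective {zero} {zero} t eq tame valid fits = stop , λ x →
    sym (fits .agrees (subst (toℕ x ℕ.<_) (trans (sym eq) (ℕ.+-identityʳ t)) (Fin.toℕ<n x) , λ ()))
  -- Once all points are treated, an open end would need a value of at least `n`.
  run-surjective {zero} {suc m} t eq {e = e} {π} tame valid fits =
    contradiction (fits .late zero)
      (ℕ.<⇒≱ (subst (toℕ (π ⟨$⟩ʳ e zero) ℕ.<_) (trans (sym eq) (ℕ.+-identityʳ t)) (Fin.toℕ<n _)))
  run-surjective {suc r} t eq {π = π} tame valid fits
    with m′ , ch , key ← key-exists valid (toℕ-point t eq) tame fits
    with c , run≈π ← run-surjective (suc t) (trans (sym (ℕ.+-suc t r)) eq) tame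
           (next-valid valid (toℕ-point t eq) ch) (fits-next valid (toℕ-point t eq) ch {π} fits key)
    = ch ∷ c , run≈π

  -- The segment is trivial unless the choice is `close`. Then it is path `k` followed by `i`, and
  -- its start is at most `π i` by the orientation of the pair.
  run-tame : ∀ {r m} t eq (c : Code r m) {σ e π} → Valid t σ e → run t eq c σ e Perm.≈ π →
             ∀ x → t ℕ.≤ toℕ x → ∃ λ s → s Fin.≤ π ⟨$⟩ʳ x × Path (π ⟨$⟩ʳ_) (Fin._< x) s x
  run-tame t eq stop valid run≈π x t≤x =
    contradiction (subst (ℕ._≤ toℕ x) (trans (sym (ℕ.+-identityʳ t)) eq) t≤x) (ℕ.<⇒≱ (Fin.toℕ<n x))
  run-tame t eq (ch ∷ c) {σ} {e} {π} valid run≈π x t≤x with ℕ.m≤n⇒m<n∨m≡n t≤x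
  ... | inj₁ t<x = run-tame (suc t) _ c {π = π} (next-valid valid (toℕ-point t eq) ch) run≈π x t<x
  ... | inj₂ t≡x = subst (λ y → ∃ λ s → s Fin.≤ π ⟨$⟩ʳ y × Path (π ⟨$⟩ʳ_) (Fin._< y) s y) i≡x
                     (go ch (run-key t eq ch c valid run≈π))
    where
    i = point t eq
    i≡t = toℕ-point t eq
    i≡x : i ≡ x
    i≡x = Fin.toℕ-injective (trans i≡t t≡x)
    go : ∀ {m′} (ch : Choice _ m′) → Key ch i σ e π →
         ∃ λ s → s Fin.≤ π ⟨$⟩ʳ i × Path (π ⟨$⟩ʳ_) (Fin._< i) s i
    go start     (_ , i<πi) = i , ℕ.<⇒≤ i<πi , []
    go fix       (_ , πi≡i) = i , Fin.≤-reflexive (sym πi≡i) , []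
    go (pass k)  (_ , i<πi) = i , ℕ.<⇒≤ i<πi , []
    go (close p) (πek≡i , πi≡σeb) = _ ,
      subst (_ Fin.≤_) (sym πi≡σeb) (sortBy-≤ (λ l → σ ⟨$⟩ʳ e l) (ends p)) ,
      start-path valid i≡t (run-fits t eq (ch ∷ c) {π = π} valid run≈π) πek≡i

  decode : Code n 0 → Permutation′ n
  decode c = run 0 refl c Perm.id ⟨⟩

  initially-valid : Valid 0 Perm.id ⟨⟩
  initially-valid = record
    { started = λ () ; distinct = λ { {()} } ; fixed = λ _ → refl ; path = λ () }

  decode-tame : ∀ c → Tame (decode c)
  decode-tame c x = run-tame 0 refl c {π = decode c} initially-valid (λ _ → refl) x ℕ.z≤n

  decode-injective : ∀ {c₁ c₂} → decode c₁ Perm.≈ decode c₂ → c₁ ≡ c₂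
  decode-injective {c₁} {c₂} eq =
    run-injective 0 refl c₁ c₂ {π = decode c₂} initially-valid eq (λ _ → refl)

  decode-surjective : ∀ {π} → Tame π → ∃ λ c → decode c Perm.≈ π
  decode-surjective {π} tame = run-surjective 0 refl {π = π} tame initially-valid
    record { agrees = λ () ; late = λ () }

-- Counting the histories

triangular : ℕ → ℕ
triangular zero    = 0
triangular (suc m) = suc m ℕ.+ triangular m

-- The Motzkin recurrence, with summands in the order `start`, `fix`, `pass`, `close`.
codes : ℕ → ℕ → ℕ
codes zero    zero    = 1
codes zero    (suc m) = 0
codes (suc r) zero    = codes r 1 ℕ.+ codes r 0
codes (suc r) (suc m) =
  codes r (2 ℕ.+ m) ℕ.+ (codes r (suc m) ℕ.+
    (suc m ℕ.* codes r (suc m) ℕ.+ triangular (suc m) ℕ.* codes r m))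

Fin-triangular : ∀ m → Fin (triangular m) ↔ Pair m
Fin-triangular zero    = mk↔ₛ′ (λ ()) (λ ()) (λ ()) (λ ())
Fin-triangular (suc m) = ↔-trans Fin.+↔⊎ (↔-trans (↔-id _ ⊎-↔ Fin-triangular m) cases)
  where
  cases : (Fin (suc m) ⊎ Pair m) ↔ Pair (suc m)
  cases = mk↔ₛ′ (λ { (inj₁ y) → here y ; (inj₂ p) → there p })
                (λ { (here y) → inj₁ y ; (there p) → inj₂ p })
                (λ { (here _) → refl ; (there _) → refl })
                (λ { (inj₁ _) → refl ; (inj₂ _) → refl })

Fin-codes : ∀ r m → Fin (codes r m) ↔ Code r m
Fin-codes zero zero    = mk↔ₛ′ (λ _ → stop) (λ _ → zero) (λ { stop → refl }) (λ { zero → refl })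
Fin-codes zero (suc m) = mk↔ₛ′ (λ ()) (λ ()) (λ ()) (λ ())
Fin-codes (suc r) zero = ↔-trans Fin.+↔⊎ (↔-trans (Fin-codes r 1 ⊎-↔ Fin-codes r 0) cases)
  where
  cases : (Code r 1 ⊎ Code r 0) ↔ Code (suc r) 0
  cases = mk↔ₛ′ (λ { (inj₁ c) → start ∷ c ; (inj₂ c) → fix ∷ c })
                (λ { (start ∷ c) → inj₁ c ; (fix ∷ c) → inj₂ c })
                (λ { (start ∷ _) → refl ; (fix ∷ _) → refl })
                (λ { (inj₁ _) → refl ; (inj₂ _) → refl })
Fin-codes (suc r) (suc m) =
  ↔-trans Fin.+↔⊎ (↔-trans (Fin-codes r (2 ℕ.+ m) ⊎-↔ rest) cases)
  where
  passes : Fin (suc m ℕ.* codes r (suc m)) ↔ (Fin (suc m) × Code r (suc m))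
  passes = ↔-trans Fin.*↔× (↔-id _ ×-↔ Fin-codes r (suc m))
  closes : Fin (triangular (suc m) ℕ.* codes r m) ↔ (Pair (suc m) × Code r m)
  closes = ↔-trans Fin.*↔× (Fin-triangular (suc m) ×-↔ Fin-codes r m)
  rest : Fin (codes r (suc m) ℕ.+ (suc m ℕ.* codes r (suc m) ℕ.+ triangular (suc m) ℕ.* codes r m)) ↔
         (Code r (suc m) ⊎ (Fin (suc m) × Code r (suc m)) ⊎ (Pair (suc m) × Code r m))
  rest = ↔-trans Fin.+↔⊎ (Fin-codes r (suc m) ⊎-↔ ↔-trans Fin.+↔⊎ (passes ⊎-↔ closes))
  cases : (Code r (2 ℕ.+ m) ⊎ Code r (suc m) ⊎
           (Fin (suc m) × Code r (suc m)) ⊎ (Pair (suc m) × Code r m))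
          ↔ Code (suc r) (suc m)
  cases = mk↔ₛ′
    (λ { (inj₁ c) → start ∷ c
       ; (inj₂ (inj₁ c)) → fix ∷ c
       ; (inj₂ (inj₂ (inj₁ (k , c)))) → pass k ∷ c
       ; (inj₂ (inj₂ (inj₂ (p , c)))) → close p ∷ c })
    (λ { (start ∷ c) → inj₁ c
       ; (fix ∷ c) → inj₂ (inj₁ c)
       ; (pass k ∷ c) → inj₂ (inj₂ (inj₁ (k , c)))
       ; (close p ∷ c) → inj₂ (inj₂ (inj₂ (p , c))) })
    (λ { (start ∷ _) → refl ; (fix ∷ _) → refl ; (pass _ ∷ _) → refl ; (close _ ∷ _) → refl })
    (λ { (inj₁ _) → refl ; (inj₂ (inj₁ _)) → refl
       ; (inj₂ (inj₂ (inj₁ _))) → refl ; (inj₂ (inj₂ (inj₂ _))) → refl })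

webPermutations-cardinality : ∀ n → HasCardinality (webPermutations n) (codes n 0)
webPermutations-cardinality n = record
  { to        = λ x → decode (code x) , Tame⇒IsWeb {π = decode (code x)} (decode-tame (code x))
  ; cong      = λ { refl _ → refl }
  ; bijective = (λ eq → Injection.injective (↔⇒↣ (Fin-codes n 0)) (decode-injective eq)) , surjective
  }
  where
  code : Fin (codes n 0) → Code n 0
  code = Inverse.to (Fin-codes n 0)
  surjective : ∀ (web : ∃ IsWeb) → ∃ λ x → ∀ {y} → y ≡ x → decode (code y) Perm.≈ proj₁ web
  surjective (π , web) with c , decode≈π ← decode-surjective {π = π} (IsWeb⇒Tame {π = π} web) =
    Inverse.from (Fin-codes n 0) c , λ
      { refl → subst (λ c → decode c Perm.≈ π)
          (sym (Inverse.strictlyInverseˡ (Fin-codes n 0) c)) decode≈π }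

-- Exponential generating functions

fromℤ : ℤ → ℚ
fromℤ a = a / 1

toℚᵘ-fromℤ : ∀ a → ℚ.toℚᵘ (fromℤ a) ℚᵘ.≃ mkℚᵘ a 0
toℚᵘ-fromℤ a = ℚ.toℚᵘ-fromℚᵘ (mkℚᵘ a 0)

fromℤ-+ : ∀ a b → fromℤ (a ℤ.+ b) ≡ fromℤ a ℚ.+ fromℤ b
fromℤ-+ a b = ℚ.toℚᵘ-injective (begin
  ℚ.toℚᵘ (fromℤ (a ℤ.+ b))                    ≈⟨ toℚᵘ-fromℤ _ ⟩
  mkℚᵘ (a ℤ.+ b) 0
    ≡⟨ cong₂ (λ x y → mkℚᵘ (x ℤ.+ y) 0) (ℤ.*-identityʳ a) (ℤ.*-identityʳ b) ⟨
  mkℚᵘ a 0 ℚᵘ.+ mkℚᵘ b 0                      ≈⟨ ℚᵘ.+-cong (toℚᵘ-fromℤ a) (toℚᵘ-fromℤ b) ⟨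
  ℚ.toℚᵘ (fromℤ a) ℚᵘ.+ ℚ.toℚᵘ (fromℤ b)      ≈⟨ ℚ.toℚᵘ-homo-+ (fromℤ a) (fromℤ b) ⟨
  ℚ.toℚᵘ (fromℤ a ℚ.+ fromℤ b)                ∎)
  where open SetoidReasoning ℚᵘ.≃-setoid

fromℤ-* : ∀ a b → fromℤ (a ℤ.* b) ≡ fromℤ a ℚ.* fromℤ b
fromℤ-* a b = ℚ.toℚᵘ-injective (begin
  ℚ.toℚᵘ (fromℤ (a ℤ.* b))                    ≈⟨ toℚᵘ-fromℤ _ ⟩
  mkℚᵘ a 0 ℚᵘ.* mkℚᵘ b 0                      ≈⟨ ℚᵘ.*-cong (toℚᵘ-fromℤ a) (toℚᵘ-fromℤ b) ⟨
  ℚ.toℚᵘ (fromℤ a) ℚᵘ.* ℚ.toℚᵘ (fromℤ b)      ≈⟨ ℚ.toℚᵘ-homo-* (fromℤ a) (fromℤ b) ⟨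
  ℚ.toℚᵘ (fromℤ a ℚ.* fromℤ b)                ∎)
  where open SetoidReasoning ℚᵘ.≃-setoid

fromℤ-*-/ : ∀ a d .{{_ : ℕ.NonZero d}} → fromℤ (ℤ.+ d) ℚ.* (a / d) ≡ fromℤ a
fromℤ-*-/ a d@(suc d-1) = ℚ.toℚᵘ-injective (begin
  ℚ.toℚᵘ (fromℤ (ℤ.+ d) ℚ.* (a / d))               ≈⟨ ℚ.toℚᵘ-homo-* (fromℤ (ℤ.+ d)) (a / d) ⟩
  ℚ.toℚᵘ (fromℤ (ℤ.+ d)) ℚᵘ.* ℚ.toℚᵘ (a / d)
    ≈⟨ ℚᵘ.*-cong (toℚᵘ-fromℤ (ℤ.+ d)) (ℚ.toℚᵘ-fromℚᵘ (mkℚᵘ a d-1)) ⟩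
  mkℚᵘ (ℤ.+ d) 0 ℚᵘ.* mkℚᵘ a d-1
    ≈⟨ *≡* (trans (ℤ.*-identityʳ _) (trans (ℤ.*-comm (ℤ.+ d) a)
         (cong (λ k → a ℤ.* ℤ.+ k) (sym (ℕ.*-identityˡ d))))) ⟩
  mkℚᵘ a 0                                         ≈⟨ toℚᵘ-fromℤ a ⟨
  ℚ.toℚᵘ (fromℤ a)                                 ∎)
  where open SetoidReasoning ℚᵘ.≃-setoid

fromℕ : ℕ → ℚ
fromℕ k = fromℤ (ℤ.+ k)

fromℕ-+ : ∀ m n → fromℕ (m ℕ.+ n) ≡ fromℕ m ℚ.+ fromℕ n
fromℕ-+ m n = fromℤ-+ (ℤ.+ m) (ℤ.+ n)

fromℕ-* : ∀ m n → fromℕ (m ℕ.* n) ≡ fromℕ m ℚ.* fromℕ n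
fromℕ-* m n = trans (cong fromℤ (ℤ.pos-* m n)) (fromℤ-* (ℤ.+ m) (ℤ.+ n))

infixl 7 _⊠_

∂ : Series → Series
∂ f = f ∘ suc

-- The product of Σ fₙ zⁿ/n! and Σ gₙ zⁿ/n!, computed by the Leibniz rule.
_⊠_ : Series → Series → Series
(f ⊠ g) zero    = f 0 ℚ.* g 0
(f ⊠ g) (suc n) = (∂ f ⊠ g) n ℚ.+ (f ⊠ ∂ g) n

𝟘 : Series
𝟘 _ = 0ℚ

⊝_ : Series → Series
(⊝ f) n = ℚ.- f n

⊠-cong : ∀ {f f′ g g′} → f ≗ f′ → g ≗ g′ → f ⊠ g ≗ f′ ⊠ g′
⊠-cong f≗ g≗ zero    = cong₂ ℚ._*_ (f≗ 0) (g≗ 0)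
⊠-cong f≗ g≗ (suc n) = cong₂ ℚ._+_ (⊠-cong (f≗ ∘ suc) g≗ n) (⊠-cong f≗ (g≗ ∘ suc) n)

⊠-congˡ : ∀ f {g g′} → g ≗ g′ → f ⊠ g ≗ f ⊠ g′
⊠-congˡ f = ⊠-cong {f} λ _ → refl

⊕-congˡ : ∀ f {g g′} → g ≗ g′ → f ⊕ g ≗ f ⊕ g′
⊕-congˡ f g≗ n = cong (f n ℚ.+_) (g≗ n)

⊠-comm : ∀ f g → f ⊠ g ≗ g ⊠ f
⊠-comm f g zero    = ℚ.*-comm (f 0) (g 0)
⊠-comm f g (suc n) = trans (cong₂ ℚ._+_ (⊠-comm (∂ f) g n) (⊠-comm f (∂ g) n))
  (ℚ.+-comm ((g ⊠ ∂ f) n) ((∂ g ⊠ f) n))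

interchange : ∀ a b c d → (a ℚ.+ b) ℚ.+ (c ℚ.+ d) ≡ (a ℚ.+ c) ℚ.+ (b ℚ.+ d)
interchange = solve 4 (λ a b c d → (a :+ b) :+ (c :+ d) := (a :+ c) :+ (b :+ d)) refl
  where open ℚ-Solver.+-*-Solver

⊠-distribʳ-⊕ : ∀ h f g → (f ⊕ g) ⊠ h ≗ f ⊠ h ⊕ g ⊠ h
⊠-distribʳ-⊕ h f g zero    = ℚ.*-distribʳ-+ (h 0) (f 0) (g 0)
⊠-distribʳ-⊕ h f g (suc n) = trans
  (cong₂ ℚ._+_ (⊠-distribʳ-⊕ h (∂ f) (∂ g) n) (⊠-distribʳ-⊕ (∂ h) f g n))
  (interchange ((∂ f ⊠ h) n) _ _ _)

⊠-distribˡ-⊕ : ∀ h f g → h ⊠ (f ⊕ g) ≗ h ⊠ f ⊕ h ⊠ g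
⊠-distribˡ-⊕ h f g n = trans (⊠-comm h (f ⊕ g) n)
  (trans (⊠-distribʳ-⊕ h f g n) (cong₂ ℚ._+_ (⊠-comm f h n) (⊠-comm g h n)))

⊠-zeroˡ : ∀ f → 𝟘 ⊠ f ≗ 𝟘
⊠-zeroˡ f zero    = ℚ.*-zeroˡ (f 0)
⊠-zeroˡ f (suc n) = cong₂ ℚ._+_ (⊠-zeroˡ f n) (⊠-zeroˡ (∂ f) n)

⊠-identityˡ : ∀ f → one ⊠ f ≗ f
⊠-identityˡ f zero    = ℚ.*-identityˡ (f 0)
⊠-identityˡ f (suc n) =
  trans (cong₂ ℚ._+_ (⊠-zeroˡ f n) (⊠-identityˡ (∂ f) n)) (ℚ.+-identityˡ _)

⊠-assoc : ∀ f g h → (f ⊠ g) ⊠ h ≗ f ⊠ (g ⊠ h)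
⊠-assoc f g h zero    = ℚ.*-assoc (f 0) (g 0) (h 0)
⊠-assoc f g h (suc n) = begin
  ((∂ f ⊠ g ⊕ f ⊠ ∂ g) ⊠ h) n ℚ.+ (f ⊠ g ⊠ ∂ h) n
    ≡⟨ cong (ℚ._+ (f ⊠ g ⊠ ∂ h) n) (⊠-distribʳ-⊕ h (∂ f ⊠ g) (f ⊠ ∂ g) n) ⟩
  ((∂ f ⊠ g ⊠ h) n ℚ.+ (f ⊠ ∂ g ⊠ h) n) ℚ.+ (f ⊠ g ⊠ ∂ h) n
    ≡⟨ ℚ.+-assoc ((∂ f ⊠ g ⊠ h) n) _ _ ⟩
  (∂ f ⊠ g ⊠ h) n ℚ.+ ((f ⊠ ∂ g ⊠ h) n ℚ.+ (f ⊠ g ⊠ ∂ h) n)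
    ≡⟨ cong₂ ℚ._+_ (⊠-assoc (∂ f) g h n) (cong₂ ℚ._+_ (⊠-assoc f (∂ g) h n) (⊠-assoc f g (∂ h) n)) ⟩
  (∂ f ⊠ (g ⊠ h)) n ℚ.+ ((f ⊠ (∂ g ⊠ h)) n ℚ.+ (f ⊠ (g ⊠ ∂ h)) n)
    ≡⟨ cong ((∂ f ⊠ (g ⊠ h)) n ℚ.+_) (⊠-distribˡ-⊕ f (∂ g ⊠ h) (g ⊠ ∂ h) n) ⟨
  (∂ f ⊠ (g ⊠ h)) n ℚ.+ (f ⊠ (∂ g ⊠ h ⊕ g ⊠ ∂ h)) n  ∎
  where open ≡-Reasoning

⊕-⊠-commutativeRing : CommutativeRing 0ℓ 0ℓ
⊕-⊠-commutativeRing = record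
  { Carrier = Series ; _≈_ = _≗_ ; _+_ = _⊕_ ; _*_ = _⊠_ ; -_ = ⊝_ ; 0# = 𝟘 ; 1# = one
  ; isCommutativeRing = record
    { isRing = record
      { +-isAbelianGroup = record
        { isGroup = record
          { isMonoid = record
            { isSemigroup = record
              { isMagma = record
                { isEquivalence = Setoid.isEquivalence (ℕ →-setoid ℚ)
                ; ∙-cong        = λ f≗ g≗ n → cong₂ ℚ._+_ (f≗ n) (g≗ n)
                }
              ; assoc = λ f g h n → ℚ.+-assoc (f n) (g n) (h n)
              }
            ; identity = (λ f n → ℚ.+-identityˡ (f n)) , λ f n → ℚ.+-identityʳ (f n)
            }
          ; inverse = (λ f n → ℚ.+-inverseˡ (f n)) , λ f n → ℚ.+-inverseʳ (f n)
          ; ⁻¹-cong = λ f≗ n → cong ℚ.-_ (f≗ n)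
          }
        ; comm = λ f g n → ℚ.+-comm (f n) (g n)
        }
      ; *-cong     = ⊠-cong
      ; *-assoc    = ⊠-assoc
      ; *-identity = ⊠-identityˡ , λ f n → trans (⊠-comm f one n) (⊠-identityˡ f n)
      ; distrib    = ⊠-distribˡ-⊕ , ⊠-distribʳ-⊕
      }
    ; *-comm = ⊠-comm
    }
  }

-- The coefficients of zⁿ/n!.
hat : Series → Series
hat f n = fromℕ (n !) ℚ.* f n

hat-one : hat one ≗ one
hat-one zero    = refl
hat-one (suc n) = ℚ.*-zeroʳ (fromℕ (suc n !))

hat-⊕ : ∀ f g → hat (f ⊕ g) ≗ hat f ⊕ hat g
hat-⊕ f g n = ℚ.*-distribˡ-+ (fromℕ (n !)) (f n) (g n)

hat-egf : ∀ a → hat (egf a) ≗ fromℤ ∘ a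
hat-egf a n = fromℤ-*-/ (a n) (n !) {{n ℕ.!≢0}}

infix 8 δ_

-- The derivative in terms of ordinary coefficients, which `hat` turns into the shift `∂`.
δ_ : Series → Series
(δ f) n = fromℕ (suc n) ℚ.* f (suc n)

hat-δ : ∀ f n → hat (δ f) n ≡ hat f (suc n)
hat-δ f n = begin
  fromℕ (n !) ℚ.* (fromℕ (suc n) ℚ.* f (suc n))  ≡⟨ ℚ.*-assoc (fromℕ (n !)) _ _ ⟨
  fromℕ (n !) ℚ.* fromℕ (suc n) ℚ.* f (suc n)    ≡⟨ cong (ℚ._* f (suc n)) (fromℕ-* (n !) (suc n)) ⟨
  fromℕ (n ! ℕ.* suc n) ℚ.* f (suc n)
    ≡⟨ cong (λ k → fromℕ k ℚ.* f (suc n)) (ℕ.*-comm (n !) (suc n)) ⟩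
  fromℕ (suc n !) ℚ.* f (suc n)                  ∎
  where open ≡-Reasoning

-- The factor `suc n` is split as k + (n + 1 - k) in the k-th summand. The parts differentiate `f`
-- and `g` respectively; the first summand of `left` and the last one of `right` vanish.
⊛-leibniz : ∀ f g → δ (f ⊛ g) ≗ δ f ⊛ g ⊕ f ⊛ δ g
⊛-leibniz f g n = begin
  fromℕ (suc n) ℚ.* sum {2 ℕ.+ n} term
    ≡⟨ *-distribˡ-sum {2 ℕ.+ n} (fromℕ (suc n)) term ⟩
  sum {2 ℕ.+ n} (λ k → fromℕ (suc n) ℚ.* term k)
    ≡⟨ sum-cong-≗ {2 ℕ.+ n} split ⟩
  sum {2 ℕ.+ n} (λ k → left k ℚ.+ right k)
    ≡⟨ ∑-distrib-+ {2 ℕ.+ n} left right ⟩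
  sum {2 ℕ.+ n} left ℚ.+ sum {2 ℕ.+ n} right
    ≡⟨ cong₂ ℚ._+_ sum-left sum-right ⟩
  (δ f ⊛ g) n ℚ.+ (f ⊛ δ g) n
    ∎
  where
  open ≡-Reasoning
  term left right : Fin (2 ℕ.+ n) → ℚ
  term  k = f (toℕ k) ℚ.* g (suc n ℕ.∸ toℕ k)
  left  k = fromℕ (toℕ k) ℚ.* term k
  right k = fromℕ (suc n ℕ.∸ toℕ k) ℚ.* term k
  split : ∀ k → fromℕ (suc n) ℚ.* term k ≡ left k ℚ.+ right k
  split k = trans
    (cong (ℚ._* term k) (trans
      (cong fromℕ (sym (ℕ.m+[n∸m]≡n (ℕ.≤-pred (Fin.toℕ<n k)))))
      (fromℤ-+ (ℤ.+ toℕ k) (ℤ.+ (suc n ℕ.∸ toℕ k)))))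
    (ℚ.*-distribʳ-+ (term k) (fromℕ (toℕ k)) (fromℕ (suc n ℕ.∸ toℕ k)))
  sum-left : sum {2 ℕ.+ n} left ≡ (δ f ⊛ g) n
  sum-left = trans (cong₂ ℚ._+_ (ℚ.*-zeroˡ (term zero))
      (sum-cong-≗ {suc n} λ k →
        sym (ℚ.*-assoc (fromℕ (suc (toℕ k))) (f (suc (toℕ k))) (g (n ℕ.∸ toℕ k)))))
    (ℚ.+-identityˡ ((δ f ⊛ g) n))
  sum-right : sum {2 ℕ.+ n} right ≡ (f ⊛ δ g) n
  sum-right = begin
    sum {2 ℕ.+ n} right
      ≡⟨ sum-init-last {suc n} right ⟩
    sum {suc n} (right ∘ Fin.inject₁) ℚ.+ right (Fin.fromℕ (suc n))
      ≡⟨ cong₂ ℚ._+_ (sum-cong-≗ {suc n} shifted) last≡0 ⟩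
    (f ⊛ δ g) n ℚ.+ 0ℚ
      ≡⟨ ℚ.+-identityʳ _ ⟩
    (f ⊛ δ g) n
      ∎
    where
    last≡0 : right (Fin.fromℕ (suc n)) ≡ 0ℚ
    last≡0 = trans
      (cong (λ k → fromℕ k ℚ.* term (Fin.fromℕ (suc n)))
        (trans (cong (suc n ℕ.∸_) (Fin.toℕ-fromℕ (suc n))) (ℕ.n∸n≡0 (suc n))))
      (ℚ.*-zeroˡ (term (Fin.fromℕ (suc n))))
    shifted : ∀ k → right (Fin.inject₁ k) ≡ f (toℕ k) ℚ.* (δ g) (n ℕ.∸ toℕ k)
    shifted k = begin
      fromℕ (suc n ℕ.∸ j) ℚ.* (f j ℚ.* g (suc n ℕ.∸ j))
        ≡⟨ cong (λ l → fromℕ (suc n ℕ.∸ l) ℚ.* (f l ℚ.* g (suc n ℕ.∸ l))) (Fin.toℕ-inject₁ k) ⟩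
      fromℕ (suc n ℕ.∸ toℕ k) ℚ.* (f (toℕ k) ℚ.* g (suc n ℕ.∸ toℕ k))
        ≡⟨ cong (λ l → fromℕ l ℚ.* (f (toℕ k) ℚ.* g l)) (ℕ.+-∸-assoc 1 (ℕ.≤-pred (Fin.toℕ<n k))) ⟩
      fromℕ (suc (n ℕ.∸ toℕ k)) ℚ.* (f (toℕ k) ℚ.* g (suc (n ℕ.∸ toℕ k)))
        ≡⟨ rearrange (fromℕ (suc (n ℕ.∸ toℕ k))) (f (toℕ k)) (g (suc (n ℕ.∸ toℕ k))) ⟩
      f (toℕ k) ℚ.* (δ g) (n ℕ.∸ toℕ k)
        ∎
      where
      j = toℕ (Fin.inject₁ k)
      rearrange : ∀ a b c → a ℚ.* (b ℚ.* c) ≡ b ℚ.* (a ℚ.* c)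
      rearrange = solve 3 (λ a b c → a :* (b :* c) := b :* (a :* c)) refl
        where open ℚ-Solver.+-*-Solver

hat-cong : ∀ {f g} → f ≗ g → hat f ≗ hat g
hat-cong f≗g n = cong (fromℕ (n !) ℚ.*_) (f≗g n)

-- Both products obey the Leibniz rule and have the same constant term; the induction on the index
-- runs over all `f` and `g` at once.
hat-⊛ : ∀ f g → hat (f ⊛ g) ≗ hat f ⊠ hat g
hat-⊛ f g zero    = lemma (f 0) (g 0)
  where
  lemma : ∀ a b → 1ℚ ℚ.* (a ℚ.* b ℚ.+ 0ℚ) ≡ (1ℚ ℚ.* a) ℚ.* (1ℚ ℚ.* b)
  lemma a b = trans (ℚ.*-identityˡ _) (trans (ℚ.+-identityʳ _)
    (cong₂ ℚ._*_ (sym (ℚ.*-identityˡ a)) (sym (ℚ.*-identityˡ b))))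
hat-⊛ f g (suc n) = begin
  hat (f ⊛ g) (suc n)                      ≡⟨ hat-δ (f ⊛ g) n ⟨
  hat (δ (f ⊛ g)) n                        ≡⟨ hat-cong (⊛-leibniz f g) n ⟩
  hat (δ f ⊛ g ⊕ f ⊛ δ g) n                ≡⟨ hat-⊕ (δ f ⊛ g) (f ⊛ δ g) n ⟩
  hat (δ f ⊛ g) n ℚ.+ hat (f ⊛ δ g) n      ≡⟨ cong₂ ℚ._+_ (hat-⊛ (δ f) g n) (hat-⊛ f (δ g) n) ⟩
  (hat (δ f) ⊠ hat g) n ℚ.+ (hat f ⊠ hat (δ g)) n
    ≡⟨ cong₂ ℚ._+_ (⊠-cong (hat-δ f) (λ _ → refl) n) (⊠-congˡ (hat f) (hat-δ g) n) ⟩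
  (∂ (hat f) ⊠ hat g) n ℚ.+ (hat f ⊠ ∂ (hat g)) n  ∎
  where open ≡-Reasoning

open CommutativeRing ⊕-⊠-commutativeRing using (commutativeSemiring)
  renaming (refl to ≗-refl; sym to ≗-sym; trans to ≗-trans; setoid to ≗-setoid; +-cong to ⊕-cong)
open NaturalCoefficients commutativeSemiring

const : ℚ → Series
const q zero    = q
const q (suc n) = 0ℚ

const-⊠ : ∀ q f n → (const q ⊠ f) n ≡ q ℚ.* f n
const-⊠ q f zero    = refl
const-⊠ q f (suc n) = trans (cong₂ ℚ._+_ (⊠-zeroˡ f n) (const-⊠ q (∂ f) n))
  (ℚ.+-identityˡ (q ℚ.* f (suc n)))

const-⊕ : ∀ p q → const (p ℚ.+ q) ≗ const p ⊕ const q
const-⊕ p q zero    = refl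
const-⊕ p q (suc n) = refl

const-1 : const 1ℚ ≗ one
const-1 zero    = refl
const-1 (suc n) = refl

nat : ℕ → Series
nat k = const (fromℕ k)

nat-+ : ∀ k l → nat (k ℕ.+ l) ≗ nat k ⊕ nat l
nat-+ k l n = trans (cong (λ q → const q n) (fromℤ-+ (ℤ.+ k) (ℤ.+ l))) (const-⊕ (fromℕ k) (fromℕ l) n)

nat-suc : ∀ k → nat (suc k) ≗ one ⊕ nat k
nat-suc k = ≗-trans (nat-+ 1 k) (⊕-cong const-1 ≗-refl)

nat-0 : nat 0 ≗ 𝟘
nat-0 zero    = refl
nat-0 (suc n) = refl

half : Series
half = const ½

half⊕half : half ⊕ half ≗ one
half⊕half = ≗-trans (≗-sym (const-⊕ ½ ½)) const-1

∂-constant : ∀ q f → ∂ (const q ⊠ f) ≗ const q ⊠ ∂ f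
∂-constant q f n = trans (const-⊠ q f (suc n)) (sym (const-⊠ q (∂ f) n))

-- Differential equations for sec + tan

C S W Z : Series
C = fromℤ ∘ cos⁽_⁾
S = fromℤ ∘ sin⁽_⁾
W = hat sec
Z = W ⊕ S ⊠ W

cos′+sin≡0 : ∀ n → cos⁽ suc n ⁾ ℤ.+ sin⁽ n ⁾ ≡ ℤ.0ℤ
cos′+sin≡0 0             = refl
cos′+sin≡0 1             = refl
cos′+sin≡0 (suc (suc n)) =
  trans (sym (ℤ.neg-distrib-+ cos⁽ suc n ⁾ sin⁽ n ⁾)) (cong ℤ.-_ (cos′+sin≡0 n))

sin′≡cos : ∀ n → sin⁽ suc n ⁾ ≡ cos⁽ n ⁾
sin′≡cos 0             = refl
sin′≡cos 1             = refl
sin′≡cos (suc (suc n)) = cong ℤ.-_ (sin′≡cos n)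

-- C′ = - S, without a minus sign so that only semiring identities are needed.
∂C⊕S : ∂ C ⊕ S ≗ 𝟘
∂C⊕S n = trans (sym (fromℤ-+ cos⁽ suc n ⁾ sin⁽ n ⁾)) (cong fromℤ (cos′+sin≡0 n))

∂S : ∂ S ≗ C
∂S n = cong fromℤ (sin′≡cos n)

C⊠W : C ⊠ W ≗ one
C⊠W n = begin
  (C ⊠ W) n        ≡⟨ ⊠-cong (hat-egf cos⁽_⁾) (λ _ → refl) n ⟨
  (hat cos ⊠ W) n  ≡⟨ hat-⊛ cos sec n ⟨
  hat (cos ⊛ sec) n  ≡⟨ hat-cong (⊛-recip cos refl) n ⟩
  hat one n          ≡⟨ hat-one n ⟩
  one n              ∎
  where open ≡-Reasoning

euler≡Z : ∀ n → euler n ≡ Z n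
euler≡Z n = begin
  hat (sec ⊕ tan) n              ≡⟨ hat-⊕ sec tan n ⟩
  W n ℚ.+ hat (sin ⊛ sec) n      ≡⟨ cong (W n ℚ.+_) (hat-⊛ sin sec n) ⟩
  W n ℚ.+ (hat sin ⊠ W) n        ≡⟨ cong (W n ℚ.+_) (⊠-cong (hat-egf sin⁽_⁾) (λ _ → refl) n) ⟩
  W n ℚ.+ (S ⊠ W) n              ∎
  where open ≡-Reasoning

pythagoras : C ⊠ C ⊕ S ⊠ S ≗ one
pythagoras zero    = refl
pythagoras (suc n) = vanish n
  where
  open SetoidReasoning ≗-setoid
  vanish : ∂ (C ⊠ C ⊕ S ⊠ S) ≗ 𝟘
  vanish = begin
    (∂ C ⊠ C ⊕ C ⊠ ∂ C) ⊕ (∂ S ⊠ S ⊕ S ⊠ ∂ S)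
      ≈⟨ ⊕-congˡ (∂ C ⊠ C ⊕ C ⊠ ∂ C) (⊕-cong (⊠-cong ∂S ≗-refl) (⊠-congˡ S ∂S)) ⟩
    (∂ C ⊠ C ⊕ C ⊠ ∂ C) ⊕ (C ⊠ S ⊕ S ⊠ C)
      ≈⟨ solve 3 (λ C′ C S → (C′ :* C :+ C :* C′) :+ (C :* S :+ S :* C) :=
                             (C′ :+ S) :* (C :+ C)) ≗-refl (∂ C) C S ⟩
    (∂ C ⊕ S) ⊠ (C ⊕ C)
      ≈⟨ ⊠-cong ∂C⊕S ≗-refl ⟩
    𝟘 ⊠ (C ⊕ C)
      ≈⟨ ⊠-zeroˡ _ ⟩
    𝟘 ∎

-- Differentiating C W = 1 gives C W′ = S W; multiplying by W = 1/C isolates W′.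
∂W : ∂ W ≗ S ⊠ (W ⊠ W)
∂W = begin
  ∂ W                          ≈⟨ ≗-sym (⊠-identityˡ (∂ W)) ⟩
  one ⊠ ∂ W                    ≈⟨ ⊠-cong (≗-sym C⊠W) ≗-refl ⟩
  (C ⊠ W) ⊠ ∂ W
    ≈⟨ solve 3 (λ C W W′ → (C :* W) :* W′ := W :* (C :* W′)) ≗-refl C W (∂ W) ⟩
  W ⊠ (C ⊠ ∂ W)                ≈⟨ ⊠-congˡ W C⊠∂W ⟩
  W ⊠ (S ⊠ W)                  ≈⟨ solve 2 (λ W S → W :* (S :* W) := S :* (W :* W)) ≗-refl W S ⟩
  S ⊠ (W ⊠ W)                  ∎
  where
  open SetoidReasoning ≗-setoid
  C⊠∂W : C ⊠ ∂ W ≗ S ⊠ W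
  C⊠∂W = begin
    C ⊠ ∂ W                           ≈⟨ solve 1 (λ x → x := con 0 :+ x) ≗-refl (C ⊠ ∂ W) ⟩
    𝟘 ⊕ C ⊠ ∂ W                       ≈⟨ ⊕-cong (≗-sym (⊠-zeroˡ W)) ≗-refl ⟩
    𝟘 ⊠ W ⊕ C ⊠ ∂ W                   ≈⟨ ⊕-cong (⊠-cong (≗-sym ∂C⊕S) ≗-refl) ≗-refl ⟩
    (∂ C ⊕ S) ⊠ W ⊕ C ⊠ ∂ W           ≈⟨ solve 5 (λ C′ S W C W′ → (C′ :+ S) :* W :+ C :* W′ :=
                                           (C′ :* W :+ C :* W′) :+ S :* W) ≗-refl (∂ C) S W C (∂ W) ⟩
    (∂ C ⊠ W ⊕ C ⊠ ∂ W) ⊕ S ⊠ W       ≈⟨ ⊕-cong (C⊠W ∘ suc) ≗-refl ⟩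
    𝟘 ⊕ S ⊠ W                         ≈⟨ solve 1 (λ x → con 0 :+ x := x) ≗-refl (S ⊠ W) ⟩
    S ⊠ W                             ∎

Y : Series
Y = ∂ Z

-- Since Z′ = (1 + S) W², the claim is 2(1 + S) W² = 1 + (1 + S)² W². Pythagoras rewrites one W² as
-- (C W)² + S² W², where C W = 1.
2Y : Y ⊕ Y ≗ one ⊕ Z ⊠ Z
2Y = begin
  Y ⊕ Y
    ≈⟨ ⊕-cong Y-closed Y-closed ⟩
  (one ⊕ S) ⊠ (W ⊠ W) ⊕ (one ⊕ S) ⊠ (W ⊠ W)
    ≈⟨ solve 2 (λ S W → (con 1 :+ S) :* (W :* W) :+ (con 1 :+ S) :* (W :* W) :=
         (con 1) :* (W :* W) :+ (W :* W :+ con 2 :* S :* W :* W)) ≗-refl S W ⟩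
  one ⊠ (W ⊠ W) ⊕ (W ⊠ W ⊕ ⟦2⟧ ⊠ S ⊠ W ⊠ W)
    ≈⟨ ⊕-cong (⊠-cong (≗-sym pythagoras) ≗-refl) ≗-refl ⟩
  (C ⊠ C ⊕ S ⊠ S) ⊠ (W ⊠ W) ⊕ (W ⊠ W ⊕ ⟦2⟧ ⊠ S ⊠ W ⊠ W)
    ≈⟨ solve 3 (λ C S W → (C :* C :+ S :* S) :* (W :* W) :+ (W :* W :+ con 2 :* S :* W :* W) :=
         (C :* W) :* (C :* W) :+ (W :+ S :* W) :* (W :+ S :* W)) ≗-refl C S W ⟩
  (C ⊠ W) ⊠ (C ⊠ W) ⊕ Z ⊠ Z
    ≈⟨ ⊕-cong (≗-trans (⊠-cong C⊠W C⊠W) (⊠-identityˡ one)) ≗-refl ⟩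
  one ⊕ Z ⊠ Z  ∎
  where
  open SetoidReasoning ≗-setoid
  ⟦2⟧ = one ⊕ one
  Y-closed : Y ≗ (one ⊕ S) ⊠ (W ⊠ W)
  Y-closed = begin
    ∂ W ⊕ (∂ S ⊠ W ⊕ S ⊠ ∂ W)
      ≈⟨ ⊕-cong ∂W (⊕-cong (⊠-cong ∂S ≗-refl) (⊠-congˡ S ∂W)) ⟩
    S ⊠ (W ⊠ W) ⊕ (C ⊠ W ⊕ S ⊠ (S ⊠ (W ⊠ W)))
      ≈⟨ solve 3 (λ C S W → S :* (W :* W) :+ (C :* W :+ S :* (S :* (W :* W))) :=
           S :* (W :* W) :+ (C :* W :* con 1 :+ S :* (S :* (W :* W)))) ≗-refl C S W ⟩
    S ⊠ (W ⊠ W) ⊕ (C ⊠ W ⊠ one ⊕ S ⊠ (S ⊠ (W ⊠ W)))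
      ≈⟨ ⊕-congˡ (S ⊠ (W ⊠ W)) (⊕-cong (⊠-congˡ (C ⊠ W) (≗-sym C⊠W)) ≗-refl) ⟩
    S ⊠ (W ⊠ W) ⊕ (C ⊠ W ⊠ (C ⊠ W) ⊕ S ⊠ (S ⊠ (W ⊠ W)))
      ≈⟨ solve 3 (λ C S W → S :* (W :* W) :+ (C :* W :* (C :* W) :+ S :* (S :* (W :* W))) :=
           ((C :* C :+ S :* S) :+ S) :* (W :* W)) ≗-refl C S W ⟩
    ((C ⊠ C ⊕ S ⊠ S) ⊕ S) ⊠ (W ⊠ W)
      ≈⟨ ⊠-cong (⊕-cong pythagoras ≗-refl) ≗-refl ⟩
    (one ⊕ S) ⊠ (W ⊠ W)  ∎

-- `Z` minus its constant term 1, defined by cases so that `∂ U` is `Y` by computation.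
U : Series
U zero    = 0ℚ
U (suc n) = Z (suc n)

Z≗1⊕U : Z ≗ one ⊕ U
Z≗1⊕U zero    = refl
Z≗1⊕U (suc n) = sym (ℚ.+-identityˡ (Z (suc n)))

halve : ∀ f g → f ⊕ f ≗ g → f ≗ half ⊠ g
halve f g f+f≗g = begin
  f                    ≈⟨ ⊠-identityˡ f ⟨
  one ⊠ f              ≈⟨ ⊠-cong half⊕half ≗-refl ⟨
  (half ⊕ half) ⊠ f    ≈⟨ solve 2 (λ h f → (h :+ h) :* f := h :* (f :+ f)) ≗-refl half f ⟩
  half ⊠ (f ⊕ f)       ≈⟨ ⊠-congˡ half f+f≗g ⟩
  half ⊠ g             ∎
  where open SetoidReasoning ≗-setoid

Y≗ : Y ≗ one ⊕ U ⊕ half ⊠ (U ⊠ U)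
Y≗ = begin
  Y
    ≈⟨ halve Y _ 2Y ⟩
  half ⊠ (one ⊕ Z ⊠ Z)
    ≈⟨ ⊠-congˡ half (⊕-congˡ one (⊠-cong Z≗1⊕U Z≗1⊕U)) ⟩
  half ⊠ (one ⊕ (one ⊕ U) ⊠ (one ⊕ U))
    ≈⟨ solve 2 (λ h U → h :* (con 1 :+ (con 1 :+ U) :* (con 1 :+ U)) :=
         (h :+ h) :+ (h :+ h) :* U :+ h :* (U :* U)) ≗-refl half U ⟩
  (half ⊕ half) ⊕ (half ⊕ half) ⊠ U ⊕ half ⊠ (U ⊠ U)
    ≈⟨ ⊕-cong (⊕-cong half⊕half (≗-trans (⊠-cong half⊕half ≗-refl) (⊠-identityˡ U))) ≗-refl ⟩
  one ⊕ U ⊕ half ⊠ (U ⊠ U)  ∎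
  where open SetoidReasoning ≗-setoid

∂Y : ∂ Y ≗ Y ⊕ U ⊠ Y
∂Y = begin
  ∂ Y
    ≈⟨ Y≗ ∘ suc ⟩
  𝟘 ⊕ Y ⊕ ∂ (half ⊠ (U ⊠ U))
    ≈⟨ ⊕-congˡ (𝟘 ⊕ Y) (∂-constant ½ (U ⊠ U)) ⟩
  𝟘 ⊕ Y ⊕ half ⊠ (Y ⊠ U ⊕ U ⊠ Y)
    ≈⟨ solve 3 (λ h U Y → con 0 :+ Y :+ h :* (Y :* U :+ U :* Y) :=
         Y :+ (h :+ h) :* (U :* Y)) ≗-refl half U Y ⟩
  Y ⊕ (half ⊕ half) ⊠ (U ⊠ Y)
    ≈⟨ ⊕-congˡ Y (≗-trans (⊠-cong half⊕half ≗-refl) (⊠-identityˡ (U ⊠ Y))) ⟩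
  Y ⊕ U ⊠ Y  ∎
  where open SetoidReasoning ≗-setoid

-- Generating functions for the completions of open paths

-- Φ m is (m + 1)!/2ᵐ Y Uᵐ.
Φ : ℕ → Series
Φ zero    = Y
Φ (suc m) = half ⊠ (nat (2 ℕ.+ m) ⊠ (U ⊠ Φ m))

previous : ℕ → Series
previous zero    = 𝟘
previous (suc m) = nat (triangular (suc m)) ⊠ Φ m

nat-triangular : ∀ m → nat (triangular m) ≗ half ⊠ (nat m ⊠ (one ⊕ nat m))
nat-triangular zero = begin
  nat 0
    ≈⟨ nat-0 ⟩
  𝟘
    ≈⟨ solve 1 (λ h → con 0 := h :* (con 0 :* (con 1 :+ con 0))) ≗-refl half ⟩
  half ⊠ (𝟘 ⊠ (one ⊕ 𝟘))
    ≈⟨ ⊠-congˡ half (⊠-cong nat-0 (⊕-congˡ one nat-0)) ⟨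
  half ⊠ (nat 0 ⊠ (one ⊕ nat 0))  ∎
  where open SetoidReasoning ≗-setoid
nat-triangular (suc m) = begin
  nat (suc m ℕ.+ triangular m)
    ≈⟨ nat-+ (suc m) (triangular m) ⟩
  nat (suc m) ⊕ nat (triangular m)
    ≈⟨ ⊕-cong (nat-suc m) (nat-triangular m) ⟩
  (one ⊕ nat m) ⊕ half ⊠ (nat m ⊠ (one ⊕ nat m))
    ≈⟨ ⊕-cong (≗-trans (⊠-cong half⊕half ≗-refl) (⊠-identityˡ (one ⊕ nat m))) ≗-refl ⟨
  (half ⊕ half) ⊠ (one ⊕ nat m) ⊕ half ⊠ (nat m ⊠ (one ⊕ nat m))
    ≈⟨ solve 2 (λ h m → (h :+ h) :* (con 1 :+ m) :+ h :* (m :* (con 1 :+ m)) :=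
         h :* ((con 1 :+ m) :* (con 1 :+ (con 1 :+ m)))) ≗-refl half (nat m) ⟩
  half ⊠ ((one ⊕ nat m) ⊠ (one ⊕ (one ⊕ nat m)))
    ≈⟨ ⊠-congˡ half (⊠-cong (nat-suc m) (⊕-congˡ one (nat-suc m))) ⟨
  half ⊠ (nat (suc m) ⊠ (one ⊕ nat (suc m)))  ∎
  where open SetoidReasoning ≗-setoid

-- The weight (m + 1)(m + 2)/2 in `previous (suc m)` is m + 1 times the factor (m + 2)/2 that takes
-- U Φ m to Φ (m + 1).
U⊠previous : ∀ m → U ⊠ previous m ≗ nat m ⊠ Φ m
U⊠previous zero = begin
  U ⊠ 𝟘        ≈⟨ solve 2 (λ U Y → U :* con 0 := con 0 :* Y) ≗-refl U Y ⟩
  𝟘 ⊠ Y        ≈⟨ ⊠-cong nat-0 ≗-refl ⟨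
  nat 0 ⊠ Y    ∎
  where open SetoidReasoning ≗-setoid
U⊠previous (suc m) = begin
  U ⊠ (nat (triangular (suc m)) ⊠ Φ m)
    ≈⟨ ⊠-congˡ U (⊠-cong (nat-triangular (suc m)) ≗-refl) ⟩
  U ⊠ (half ⊠ (nat (suc m) ⊠ (one ⊕ nat (suc m))) ⊠ Φ m)
    ≈⟨ solve 4 (λ U h k g → U :* (h :* (k :* (con 1 :+ k)) :* g) :=
         k :* (h :* ((con 1 :+ k) :* (U :* g)))) ≗-refl U half (nat (suc m)) (Φ m) ⟩
  nat (suc m) ⊠ (half ⊠ ((one ⊕ nat (suc m)) ⊠ (U ⊠ Φ m)))
    ≈⟨ ⊠-congˡ (nat (suc m)) (⊠-congˡ half (⊠-cong (nat-suc (suc m)) ≗-refl)) ⟨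
  nat (suc m) ⊠ Φ (suc m)  ∎
  where open SetoidReasoning ≗-setoid

-- These are the weights of the recurrence of `codes`. By induction, the product rule with U′ = 1 +
-- U + U²/2 reduces the equation to a polynomial identity.
∂Φ : ∀ m → ∂ (Φ m) ≗ Φ (suc m) ⊕ (nat (suc m) ⊠ Φ m ⊕ previous m)
∂Φ zero = begin
  ∂ Y
    ≈⟨ ∂Y ⟩
  Y ⊕ U ⊠ Y
    ≈⟨ ⊕-congˡ Y (≗-trans (⊠-cong half⊕half ≗-refl) (⊠-identityˡ (U ⊠ Y))) ⟨
  Y ⊕ (half ⊕ half) ⊠ (U ⊠ Y)
    ≈⟨ solve 3 (λ h U Y → Y :+ (h :+ h) :* (U :* Y) :=
         h :* ((con 1 :+ con 1) :* (U :* Y)) :+ (con 1 :* Y :+ con 0)) ≗-refl half U Y ⟩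
  half ⊠ ((one ⊕ one) ⊠ (U ⊠ Y)) ⊕ (one ⊠ Y ⊕ 𝟘)
    ≈⟨ ⊕-cong (⊠-congˡ half (⊠-cong (≗-trans (nat-suc 1) (⊕-congˡ one const-1)) ≗-refl))
         (⊕-cong (⊠-cong const-1 ≗-refl) (≗-refl {𝟘})) ⟨
  Φ 1 ⊕ (nat 1 ⊠ Y ⊕ 𝟘)  ∎
  where open SetoidReasoning ≗-setoid
∂Φ (suc m) = begin
  ∂ (Φ (suc m))
    ≈⟨ ∂-constant ½ (nat (2 ℕ.+ m) ⊠ (U ⊠ g)) ⟩
  half ⊠ ∂ (nat (2 ℕ.+ m) ⊠ (U ⊠ g))
    ≈⟨ ⊠-congˡ half (∂-constant (fromℕ (2 ℕ.+ m)) (U ⊠ g)) ⟩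
  half ⊠ (nat (2 ℕ.+ m) ⊠ (Y ⊠ g ⊕ U ⊠ ∂ g))
    ≈⟨ ⊠-congˡ half (⊠-congˡ (nat (2 ℕ.+ m)) (⊕-cong (⊠-cong Y≗ ≗-refl) U⊠∂g)) ⟩
  half ⊠ (nat (2 ℕ.+ m) ⊠ ((one ⊕ U ⊕ half ⊠ (U ⊠ U)) ⊠ g ⊕ (U ⊠ g₁ ⊕ (k ⊠ (U ⊠ g) ⊕ nat m ⊠ g))))
    ≈⟨ ⊠-congˡ half (⊠-cong (nat-suc (suc m)) ≗-refl) ⟩
  half ⊠ ((one ⊕ k) ⊠ ((one ⊕ U ⊕ half ⊠ (U ⊠ U)) ⊠ g ⊕ (U ⊠ g₁ ⊕ (k ⊠ (U ⊠ g) ⊕ nat m ⊠ g))))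
    -- Here `g₁` is h(1 + k) U g. Terms in `g` alone give the triangular weight, terms in U g give
    -- (1 + k) `g₁`, and the term in U² g gives one more h U `g₁`, raising the coefficient 1 + k of
    -- the latter to 2 + k.
    ≈⟨ solve 6 (λ h k m U g g₁ →
         h :* ((con 1 :+ k) :* ((con 1 :+ U :+ h :* (U :* U)) :* g
           :+ (U :* g₁ :+ (k :* (U :* g) :+ m :* g)))) :=
         (h :* (U :* (h :* ((con 1 :+ k) :* (U :* g)))) :+ h :* ((con 1 :+ k) :* (U :* g₁)))
           :+ ((con 1 :+ k) :* (h :* ((con 1 :+ k) :* (U :* g)))
           :+ h :* ((con 1 :+ m) :* (con 1 :+ k)) :* g))
         ≗-refl half k (nat m) U g g₁ ⟩
  (half ⊠ (U ⊠ (half ⊠ ((one ⊕ k) ⊠ (U ⊠ g)))) ⊕ half ⊠ ((one ⊕ k) ⊠ (U ⊠ g₁)))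
    ⊕ ((one ⊕ k) ⊠ (half ⊠ ((one ⊕ k) ⊠ (U ⊠ g))) ⊕ half ⊠ ((one ⊕ nat m) ⊠ (one ⊕ k)) ⊠ g)
    ≈⟨ ⊕-cong (⊕-cong (⊠-congˡ half (⊠-congˡ U g₁≗)) ≗-refl)
         (⊕-cong (⊠-congˡ (one ⊕ k) g₁≗) (⊠-cong (⊠-congˡ half (⊠-cong (nat-suc m) ≗-refl)) ≗-refl)) ⟨
  (half ⊠ (U ⊠ g₁) ⊕ half ⊠ ((one ⊕ k) ⊠ (U ⊠ g₁)))
    ⊕ ((one ⊕ k) ⊠ g₁ ⊕ half ⊠ (k ⊠ (one ⊕ k)) ⊠ g)
    ≈⟨ ⊕-cong (solve 4 (λ h k U g₁ → h :* (U :* g₁) :+ h :* ((con 1 :+ k) :* (U :* g₁)) :=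
           h :* ((con 1 :+ (con 1 :+ k)) :* (U :* g₁))) ≗-refl half k U g₁)
         (⊕-cong (⊠-cong (≗-sym (nat-suc (suc m))) ≗-refl)
                 (⊠-cong (≗-sym (nat-triangular (suc m))) ≗-refl)) ⟩
  half ⊠ ((one ⊕ (one ⊕ k)) ⊠ (U ⊠ g₁)) ⊕ (nat (2 ℕ.+ m) ⊠ g₁ ⊕ previous (suc m))
    ≈⟨ ⊕-cong (⊠-congˡ half (⊠-cong (≗-trans (nat-suc (2 ℕ.+ m))
         (⊕-congˡ one (nat-suc (suc m)))) ≗-refl)) ≗-refl ⟨
  Φ (2 ℕ.+ m) ⊕ (nat (2 ℕ.+ m) ⊠ g₁ ⊕ previous (suc m))  ∎
  where
  open SetoidReasoning ≗-setoid
  g g₁ k : Series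
  g  = Φ m
  g₁ = Φ (suc m)
  k  = nat (suc m)
  g₁≗ : g₁ ≗ half ⊠ ((one ⊕ k) ⊠ (U ⊠ g))
  g₁≗ = ⊠-congˡ half (⊠-cong (nat-suc (suc m)) ≗-refl)
  U⊠∂g : U ⊠ ∂ g ≗ U ⊠ g₁ ⊕ (k ⊠ (U ⊠ g) ⊕ nat m ⊠ g)
  U⊠∂g = begin
    U ⊠ ∂ g
      ≈⟨ ⊠-congˡ U (∂Φ m) ⟩
    U ⊠ (g₁ ⊕ (k ⊠ g ⊕ previous m))
      ≈⟨ solve 5 (λ U g₁ k g p → U :* (g₁ :+ (k :* g :+ p)) := U :* g₁ :+ (k :* (U :* g) :+ U :* p))
           ≗-refl U g₁ k g (previous m) ⟩
    U ⊠ g₁ ⊕ (k ⊠ (U ⊠ g) ⊕ U ⊠ previous m)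
      ≈⟨ ⊕-congˡ (U ⊠ g₁) (⊕-congˡ (k ⊠ (U ⊠ g)) (U⊠previous m)) ⟩
    U ⊠ g₁ ⊕ (k ⊠ (U ⊠ g) ⊕ nat m ⊠ g)  ∎

-- Both sides satisfy the same recurrence in `r`. For `r ≡ 0` they agree because `U` has constant
-- term 0 and `Y` has constant term 1.
codes≡Φ : ∀ r m → fromℕ (codes r m) ≡ Φ m r
codes≡Φ zero    zero    = sym (trans (Y≗ 0) refl)
codes≡Φ zero    (suc m) = sym (trans (cong (λ q → ½ ℚ.* (fromℕ (2 ℕ.+ m) ℚ.* q)) (ℚ.*-zeroˡ (Φ m 0)))
  (trans (cong (½ ℚ.*_) (ℚ.*-zeroʳ (fromℕ (2 ℕ.+ m)))) (ℚ.*-zeroʳ ½)))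
codes≡Φ (suc r) zero    = begin
  fromℕ (codes r 1 ℕ.+ codes r 0)      ≡⟨ fromℕ-+ (codes r 1) (codes r 0) ⟩
  fromℕ (codes r 1) ℚ.+ fromℕ (codes r 0)
    ≡⟨ cong₂ ℚ._+_ (codes≡Φ r 1) (codes≡Φ r 0) ⟩
  Φ 1 r ℚ.+ Φ 0 r
    ≡⟨ cong (Φ 1 r ℚ.+_) (trans (ℚ.+-identityʳ _)
         (trans (const-⊠ 1ℚ (Φ 0) r) (ℚ.*-identityˡ (Φ 0 r)))) ⟨
  Φ 1 r ℚ.+ ((nat 1 ⊠ Φ 0) r ℚ.+ 0ℚ)   ≡⟨ ∂Φ 0 r ⟨
  Φ 0 (suc r)                          ∎
  where open ≡-Reasoning
codes≡Φ (suc r) (suc m) = begin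
  fromℕ (a ℕ.+ (b ℕ.+ (suc m ℕ.* b ℕ.+ triangular (suc m) ℕ.* d)))
    -- `fix` and the m + 1 ways to `pass` combine to the factor m + 2.
    ≡⟨ cong (λ l → fromℕ (a ℕ.+ l)) (ℕ.+-assoc b (suc m ℕ.* b) (triangular (suc m) ℕ.* d)) ⟨
  fromℕ (a ℕ.+ ((2 ℕ.+ m) ℕ.* b ℕ.+ triangular (suc m) ℕ.* d))
    ≡⟨ trans (fromℕ-+ a _) (cong (fromℕ a ℚ.+_)
         (fromℕ-+ ((2 ℕ.+ m) ℕ.* b) (triangular (suc m) ℕ.* d))) ⟩
  fromℕ a ℚ.+ (fromℕ ((2 ℕ.+ m) ℕ.* b) ℚ.+ fromℕ (triangular (suc m) ℕ.* d))
    ≡⟨ cong₂ ℚ._+_ (codes≡Φ r (2 ℕ.+ m)) (cong₂ ℚ._+_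
         (scaled (2 ℕ.+ m) b (Φ (suc m)) (codes≡Φ r (suc m)))
         (scaled (triangular (suc m)) d (Φ m) (codes≡Φ r m))) ⟩
  Φ (2 ℕ.+ m) r ℚ.+ ((nat (2 ℕ.+ m) ⊠ Φ (suc m)) r ℚ.+ (nat (triangular (suc m)) ⊠ Φ m) r)
    ≡⟨ ∂Φ (suc m) r ⟨
  Φ (suc m) (suc r)  ∎
  where
  open ≡-Reasoning
  a = codes r (2 ℕ.+ m)
  b = codes r (suc m)
  d = codes r m
  scaled : ∀ k l f → fromℕ l ≡ f r → fromℕ (k ℕ.* l) ≡ (nat k ⊠ f) r
  scaled k l f l≡ = trans (fromℕ-* k l) (trans (cong (fromℕ k ℚ.*_) l≡) (sym (const-⊠ (fromℕ k) f r)))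

codes≡euler : ∀ n → fromℕ (codes n 0) ≡ euler (suc n)
codes≡euler n = trans (codes≡Φ n 0) (sym (euler≡Z (suc n)))

corollary4p2 : ∀ (n : ℕ) → 1 ≤ n →
    ∃ λ k → HasCardinality (webPermutations n) k × + k / 1 ≡ euler (suc n)
corollary4p2 n _ = codes n 0 , webPermutations-cardinality n , codes≡euler n
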